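{- If $T\ne K_1$ is a tree and if $\mathcal{F}$ is a family of graphs which contains a forest, then either $\mathrm{ex}(n,T,\mathcal{F})=\Theta(n^k)$ for some integer $k\le \alpha(T)$ or $\mathrm{ex}(n,T,\mathcal{F})=0$ for all sufficiently large $n$.
   Context: Graphs are finite and simple. $\alpha(T)$ denotes the independence number of $T$. A graph is $\mathcal{F}$-free, for a family of graphs $\mathcal{F}$, if it contains no (not necessarily induced) subgraph isomorphic to a member of $\mathcal{F}$. $\mathrm{ex}(n,T,\mathcal{F})$ is the maximum number of copies of $T$ (subgraphs isomorphic to $T$) that an $n$-vertex $\mathcal{F}$-free graph can have, with the convention that it is $0$ if there is no $\mathcal{F}$-free graph on $n$ vertices. Asymptotics are as $n\to\infty$, with $T$ and $\mathcal{F}$ fixed. -}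

module Defs where

open import Axiom.ExcludedMiddle using (ExcludedMiddle)
open import Data.Bool.Base using (true; false)
open import Data.Fin.Base using (Fin; zero; suc; fromℕ; inject₁)
open import Data.Fin.Properties using (any?; all?) renaming (_≟_ to _≟ᶠ_)
open import Data.Fin.Subset using (Subset; _∈_; ⊤; ⊥; ∣_∣)
open import Data.Fin.Subset.Properties using (_∈?_; ∉⊥)
open import Data.List.Base
  using (List; []; _∷_; [_]; map; filter; length; mapMaybe; cartesianProduct; cartesianProductWith)
open import Data.List.Extrema.Nat using (max)
open import Data.Maybe.Base as Maybe using (Maybe)
open import Data.Nat.Base using (ℕ; zero; suc; _+_; _*_; _≤_)
open import Data.Product.Base using (∃; ∃₂; _×_; _,_; uncurry)
open import Data.Vec.Base as Vec using (Vec; lookup)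
open import Data.Vec.Functional as Vector using (Vector)
open import Function.Base using (_∘_)
open import Function.Bundles using (_⇔_; mk⇔; Equivalence)
open import Function.Definitions using (Injective)
open import Level using (Level; 0ℓ) renaming (suc to lsuc)
open import Relation.Binary.Construct.Closure.ReflexiveTransitive using (Star)
open import Relation.Binary.Core using (Rel)
open import Relation.Binary.Definitions using (Symmetric; Irreflexive)
open import Relation.Binary.PropositionalEquality
  using (_≡_; _≗_; refl; sym; trans; subst₂)
open import Relation.Nullary.Decidable
  using (Dec; map′; ¬?; _×-dec_; _→-dec_; dec⇒maybe)
open import Relation.Nullary.Negation using (¬_)
open import Relation.Unary using (Pred; Decidable)

infix 4 _≅_ _=O_ _=Θ_

private
  variable
    ℓ : Level
    m n : ℕ

-- A graph on Fin n is stored as the vector of its neighbourhoods, so that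
-- adjacency is decidable and the graphs on Fin n can be listed.

Adjacency : ℕ → Set
Adjacency n = Vec (Subset n) n

Edge : Adjacency n → Rel (Fin n) 0ℓ
Edge A u v = v ∈ lookup A u

record IsSimple (A : Adjacency n) : Set where
  field
    symmetric   : Symmetric (Edge A)
    irreflexive : Irreflexive _≡_ (Edge A)

record Graph (n : ℕ) : Set where
  field
    adjacency : Adjacency n
    isSimple  : IsSimple adjacency

  open IsSimple isSimple public

open Graph public using (adjacency)

Adj : Graph n → Rel (Fin n) 0ℓ
Adj G = Edge (adjacency G)

K₁ : Graph 1
K₁ = record
  { adjacency = ⊥ Vec.∷ Vec.[]
  ; isSimple  = record
    { symmetric   = λ { {zero} {zero} e → e }
    ; irreflexive = λ { {zero} refl e → ∉⊥ e }
    }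
  }

-- A copy is a vertex set together with an edge set, hence copies are counted
-- as subgraphs and not as embeddings.

Candidate : ℕ → Set
Candidate n = Subset n × Adjacency n

record IsSubgraph (G : Graph n) (S : Subset n) (E : Adjacency n) : Set where
  constructor mkIsSubgraph
  field
    symmetric : Symmetric (Edge E)
    endpoints : ∀ u v → Edge E u v → u ∈ S
    edges     : ∀ u v → Edge E u v → Adj G u v

record IsIsomorphism (H : Graph m) (S : Subset n) (E : Adjacency n)
                     (f : Fin m → Fin n) : Set where
  constructor mkIsIsomorphism
  field
    injective : Injective _≡_ _≡_ f
    image     : ∀ v → v ∈ S ⇔ ∃ λ u → f u ≡ v
    edges     : ∀ u v → Adj H u v ⇔ Edge E (f u) (f v)

IsCopy : Graph m → Graph n → Pred (Candidate n) 0ℓ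
IsCopy H G (S , E) = IsSubgraph G S E × ∃ (IsIsomorphism H S E)

Contains : Graph n → Graph m → Set
Contains G H = ∃ (IsCopy H G)

_≅_ : Graph m → Graph n → Set
G ≅ H = ∃ (IsIsomorphism G ⊤ (adjacency H))

record Cycle (G : Graph n) : Set where
  field
    {excess}  : ℕ
    vertex    : Fin (3 + excess) → Fin n
    injective : Injective _≡_ _≡_ vertex
    steps     : ∀ i → Adj G (vertex (inject₁ i)) (vertex (suc i))
    closes    : Adj G (vertex (fromℕ (2 + excess))) (vertex zero)

IsForest : Graph n → Set
IsForest G = ¬ Cycle G

record IsTree (G : Graph n) : Set where
  field
    nonempty  : Fin n
    connected : ∀ u v → Star (Adj G) u v
    acyclic   : IsForest G

-- A family may be infinite, and need not be decidable or closed under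
-- isomorphism.

Family : ∀ ℓ → Set (lsuc ℓ)
Family ℓ = ∀ m → Pred (Graph m) ℓ

Free : Family ℓ → Pred (Graph n) ℓ
Free ℱ G = ∀ {m} (H : Graph m) → ℱ m H → ¬ Contains G H

private
  ⇔-dec : ∀ {A B : Set} → Dec A → Dec B → Dec (A ⇔ B)
  ⇔-dec a? b? = map′ (uncurry mk⇔)
    (λ e → Equivalence.to e , Equivalence.from e)
    ((a? →-dec b?) ×-dec (b? →-dec a?))

  anyVector? : {P : Pred (Vector (Fin n) m) 0ℓ} →
               (∀ {f g} → f ≗ g → P f → P g) → Decidable P → Dec (∃ P)
  anyVector? {m = zero} resp P? =
    map′ (_ ,_) (λ (_ , p) → resp (λ ()) p) (P? Vector.[])
  anyVector? {m = suc m} resp P? =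
    map′ (λ (x , f , p) → (x Vector.∷ f) , p)
         (λ (f , p) → f zero , f ∘ suc ,
            resp (λ { zero → refl ; (suc _) → refl }) p)
         (any? λ x → anyVector?
            (λ f≗g → resp λ { zero → refl ; (suc i) → f≗g i })
            (λ f → P? (x Vector.∷ f)))

  edge? : (A : Adjacency n) → ∀ u v → Dec (Edge A u v)
  edge? A u v = v ∈? lookup A u

  symmetric? : (A : Adjacency n) → Dec (Symmetric (Edge A))
  symmetric? A = map′ (λ s {u} {v} → s u v) (λ s u v → s {u} {v})
    (all? λ u → all? λ v → edge? A u v →-dec edge? A v u)

isSimple? : Decidable (IsSimple {n})
isSimple? A = map′
  (λ (s , i) → record { symmetric = λ {u} {v} → s {u} {v} ; irreflexive = λ { {u} refl → i u } })
  (λ p → (λ {u} {v} → IsSimple.symmetric p {u} {v}) , λ u → IsSimple.irreflexive p refl)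
  (symmetric? A ×-dec all? λ u → ¬? (edge? A u u))

isSubgraph? : (G : Graph n) → ∀ S E → Dec (IsSubgraph G S E)
isSubgraph? G S E = map′
  (λ (s , p , e) → mkIsSubgraph (λ {u} {v} → s {u} {v}) p e)
  (λ (mkIsSubgraph s p e) → (λ {u} {v} → s {u} {v}) , p , e)
  (symmetric? E
   ×-dec (all? λ u → all? λ v → edge? E u v →-dec (u ∈? S))
   ×-dec (all? λ u → all? λ v → edge? E u v →-dec edge? (adjacency G) u v))

isIsomorphism? : (H : Graph m) (S : Subset n) (E : Adjacency n) →
                 Decidable (IsIsomorphism H S E)
isIsomorphism? H S E f = map′
  (λ (i , s , e) → mkIsIsomorphism (λ {u} {v} → i u v) s e)
  (λ (mkIsIsomorphism i s e) → (λ u v → i) , s , e)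
  ((all? λ u → all? λ v → (f u ≟ᶠ f v) →-dec (u ≟ᶠ v))
   ×-dec (all? λ v → ⇔-dec (v ∈? S) (any? λ u → f u ≟ᶠ v))
   ×-dec (all? λ u → all? λ v →
            ⇔-dec (edge? (adjacency H) u v) (edge? E (f u) (f v))))

isIsomorphism-resp-≗ : (H : Graph m) (S : Subset n) (E : Adjacency n)
                       {f g : Fin m → Fin n} → f ≗ g →
                       IsIsomorphism H S E f → IsIsomorphism H S E g
isIsomorphism-resp-≗ H S E f≗g (mkIsIsomorphism i s e) = mkIsIsomorphism
  (λ {u} {v} eq → i (trans (f≗g u) (trans eq (sym (f≗g v)))))
  (λ v → mk⇔
     (λ v∈S → let (u , fu≡v) = Equivalence.to (s v) v∈S
              in u , trans (sym (f≗g u)) fu≡v)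
     (λ (u , gu≡v) → Equivalence.from (s v) (u , trans (f≗g u) gu≡v)))
  (λ u v → mk⇔
     (λ a → subst₂ (Edge E) (f≗g u) (f≗g v) (Equivalence.to (e u v) a))
     (λ b → Equivalence.from (e u v)
              (subst₂ (Edge E) (sym (f≗g u)) (sym (f≗g v)) b)))

isCopy? : (H : Graph m) (G : Graph n) → Decidable (IsCopy H G)
isCopy? H G (S , E) = isSubgraph? G S E
  ×-dec anyVector? (isIsomorphism-resp-≗ H S E) (isIsomorphism? H S E)

-- The lists below are exhaustive and free of repetitions, so that filtering
-- them counts.

vectors : {A : Set} → List A → ∀ k → List (Vec A k)
vectors xs zero    = [ Vec.[] ]
vectors xs (suc k) = cartesianProductWith Vec._∷_ xs (vectors xs k)

subsets : ∀ n → List (Subset n)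
subsets n = vectors (true ∷ false ∷ []) n

adjacencies : ∀ n → List (Adjacency n)
adjacencies n = vectors (subsets n) n

candidates : ∀ n → List (Candidate n)
candidates n = cartesianProduct (subsets n) (adjacencies n)

toGraph : Adjacency n → Maybe (Graph n)
toGraph A = Maybe.map (λ p → record { adjacency = A ; isSimple = p })
                      (dec⇒maybe (isSimple? A))

graphs : ∀ n → List (Graph n)
graphs n = mapMaybe toGraph (adjacencies n)

IsIndependent : Graph n → Pred (Subset n) 0ℓ
IsIndependent G S = ∀ u v → u ∈ S → v ∈ S → ¬ Adj G u v

isIndependent? : (G : Graph n) → Decidable (IsIndependent G)
isIndependent? G S = all? λ u → all? λ v →
  (u ∈? S) →-dec ((v ∈? S) →-dec ¬? (edge? (adjacency G) u v))

α : Graph n → ℕ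
α {n} G = max 0 (map ∣_∣ (filter (isIndependent? G) (subsets n)))

#copies : Graph m → Graph n → ℕ
#copies {n = n} T G = length (filter (isCopy? T G) (candidates n))

-- Excluded middle serves to decide ℱ-freeness for an arbitrary family ℱ.
-- The first argument of max is the value when no graph is ℱ-free.

ex : ExcludedMiddle ℓ → ℕ → Graph m → Family ℓ → ℕ
ex em n T ℱ = max 0 (map (#copies T) (filter (λ G → em {Free ℱ G}) (graphs n)))

-- For functions into ℕ the implied constants may be taken in ℕ: an upper
-- constant can be rounded up, and a lower bound c * g ≤ f with c > 0 is
-- g ≤ (1 / c) * f.

_=O_ : (f g : ℕ → ℕ) → Set
f =O g = ∃₂ λ C N → ∀ n → N ≤ n → f n ≤ C * g n

_=Θ_ : (f g : ℕ → ℕ) → Set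
f =Θ g = f =O g × g =O f

{-# OPTIONS --safe #-}
-- Call a subtree C of T rich for an embedding h of T in G if no s vertices of G meet all the ways of
-- re-embedding C while keeping h outside C. If some h has k rich subtrees, pairwise disjoint and
-- non-adjacent, for every s, then blowing them up independently gives Ω(n^k) copies of T, and
-- k ≤ α(T) as the tops of the subtrees are independent.
-- Conversely, subtrees of a tree pack as well as they are pierced: if no h has k + 1 such subtrees,
-- then k vertices and edges of T meet all rich subtrees of h. Once h is fixed on these, a branching
-- argument leaves boundedly many h, while an ℱ-free graph has O(n) edges because a graph of large
-- minimum degree contains every forest. Hence there are O(n^k) copies.

module Submission where

open import Defs
open import Axiom.ExcludedMiddle using (ExcludedMiddle)
open import Data.Bool.Base using (true; false)
open import Data.Empty using (⊥-elim)
open import Data.Fin.Base using (Fin; zero; suc; toℕ; combine; remQuot)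
open import Data.Fin.Properties
  using (any?; all?; toℕ-injective; toℕ<n; toℕ-inject₁; toℕ-fromℕ; injective⇒≤;
         ℕ→Fin-notInjective; remQuot-combine; combine-injectiveˡ; combine-injectiveʳ)
  renaming (_≟_ to _≟ᶠ_; suc-injective to sucᶠ-injective; 0≢1+n to 0≢1+nᶠ)
open import Data.Fin.Subset using (Subset; _∈_; _∉_; _⊆_; _-_; ⊤; ∣_∣)
open import Data.Fin.Subset.Properties
  using (_∈?_; nonempty?; ⊆-antisym; ∣⊤∣≡n; ∣p∣≤n; ∈⊤; x∈p∧x≢y⇒x∈p-y; x∈p⇒∣p-x∣<∣p∣; p─q⊆p)
open import Data.List.Base as List
  using (List; []; _∷_; [_]; _++_; map; length; concat; concatMap; cartesianProduct;
         cartesianProductWith; allFin; tabulate; deduplicate)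
open import Data.List.Extrema.Nat using (max≤v⁺; v≤max⁺)
open import Data.List.Membership.Propositional
  using (find; lose)
  renaming (_∈_ to _∈ˡ_; _∉_ to _∉ˡ_)
open import Data.List.Membership.Propositional.Properties
  using (∈-lookup; ∈-allFin; ∈-cartesianProductWith⁺; ∈-cartesianProduct⁺; ∈-filter⁺; ∈-filter⁻;
         ∈-tabulate⁺; ∈-concat⁺′; ∈-++⁺ˡ; ∈-++⁺ʳ; ∈-map⁺; ∈-map⁻; ∈-deduplicate⁺)
open import Data.List.Properties
  using (length-map; length-++; length-tabulate; length-deduplicate)
open import Data.List.Relation.Unary.All as All using (All; []; _∷_)
import Data.List.Relation.Unary.All.Properties as Allₚ
open import Data.List.Relation.Unary.Any as Any using (Any; here; there)
import Data.List.Relation.Unary.Any.Properties as Anyₚ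
open import Data.List.Relation.Unary.Unique.Propositional using (Unique; []; _∷_)
import Data.List.Relation.Unary.Unique.Propositional.Properties as Uniqueₚ
import Data.List.Relation.Unary.Unique.DecPropositional.Properties as UniqueDecₚ
import Data.Maybe.Relation.Unary.Any as MaybeAny
open import Data.Nat.Base
open import Data.Nat.DivMod using (m≡m%n+[m/n]*n; m/n*n≤m; m%n<n; m≥n⇒m/n>0)
open import Data.Nat.Induction using (<-rec)
open import Data.Nat.Properties
open import Data.Product.Base using (∃; ∃₂; _×_; _,_; proj₁; proj₂)
open import Data.Sum.Base using (_⊎_; inj₁; inj₂)
open import Data.Vec.Base as Vec using (Vec; lookup)
open import Data.Vec.Functional using (updateAt)
open import Data.Vec.Functional.Properties using (updateAt-updates; updateAt-minimal)
open import Data.Vec.Properties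
  using (lookup∘tabulate; lookup-map; lookup⇒[]=; []=⇒lookup; ∷-injective)
open import Function.Base using (_∘_; id; case_of_)
open import Function.Bundles using (mk⇔; Equivalence)
open import Function.Definitions using (Injective)
open import Level using (Level; 0ℓ; Lift; lift; lower)
open import Relation.Binary.Definitions using (tri<; tri≈; tri>)
open import Relation.Binary.PropositionalEquality
  using (_≡_; _≢_; _≗_; refl; sym; trans; cong; cong₂; subst; subst₂; module ≡-Reasoning)
open import Relation.Nullary.Decidable
  using (Dec; yes; no; does; dec-true; map′; decidable-stable; _×-dec_; _→-dec_; _⊎-dec_; ¬?)
open import Relation.Nullary.Negation using (¬_; contradiction)
open import Relation.Unary using (Pred; Decidable)

-- Non-adjacency of the parts is what lets independently chosen copies fit together. It also means
-- that disjoint but adjacent subtrees compete for a place in a packing. No single vertex pierces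
-- both, but the edge from a vertex to its parent does, so edges must be allowed as piercing
-- objects. Fixing the image of an edge must then cost no more than fixing that of a vertex. It
-- costs O(n), which is where the forest in ℱ enters, and so the two exponents agree. Richness
-- speaks of sets to avoid because both directions can use this directly: its failure supplies the
-- set on which to branch, and its success lets disjoint copies be chosen greedily. The graph and
-- `h` may vary with `s`, so when packings of size k + 1 fail to exist, a single `s` works for all
-- large ℱ-free graphs, and the constants do not depend on n. Conversely, the graphs that carry
-- packings have uncontrolled orders. The lower bound still holds at every large n, since a blow-up
-- can be cut down to n vertices and ℱ-freeness is inherited.

private
  variable
    a ℓ : Level
    m n t : ℕ
    A B : Set a

-- Subsets and lists

comprehension : {P : Pred (Fin n) ℓ} → Decidable P → Subset n
comprehension P? = Vec.tabulate (does ∘ P?)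

module _ {P : Pred (Fin n) ℓ} (P? : Decidable P) where

  ∈-comprehension⁺ : ∀ {x} → P x → x ∈ comprehension P?
  ∈-comprehension⁺ {x} px =
    lookup⇒[]= x _ (trans (lookup∘tabulate _ x) (dec-true (P? x) px))

  ∈-comprehension⁻ : ∀ {x} → x ∈ comprehension P? → P x
  ∈-comprehension⁻ {x} x∈ =
    holds (P? x) (trans (sym (lookup∘tabulate (does ∘ P?) x)) ([]=⇒lookup x∈))
    where
    holds : ∀ {p} {Q : Set p} (Q? : Dec Q) → does Q? ≡ true → Q
    holds (yes q) _ = q

x∈p-y⇒x∈p : ∀ (p : Subset n) {x y} → x ∈ p - y → x ∈ p
x∈p-y⇒x∈p p = p─q⊆p p _

injective⇒≤∣p∣ : ∀ {k} (p : Subset n) {f : Fin k → Fin n} →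
                 Injective _≡_ _≡_ f → (∀ i → f i ∈ p) → k ≤ ∣ p ∣
injective⇒≤∣p∣ {k = zero}  p inj f∈p = z≤n
injective⇒≤∣p∣ {k = suc k} p {f} inj f∈p = ≤-trans
  (s≤s (injective⇒≤∣p∣ (p - f zero) {f ∘ suc} (sucᶠ-injective ∘ inj)
    λ i → x∈p∧x≢y⇒x∈p-y (f∈p (suc i)) (0≢1+nᶠ ∘ sym ∘ inj)))
  (x∈p⇒∣p-x∣<∣p∣ (f∈p zero))

Unique⇒lookup-injective : {xs : List A} → Unique xs → Injective _≡_ _≡_ (List.lookup xs)
Unique⇒lookup-injective (x∉ ∷ xs!) {zero}  {zero}  eq = refl
Unique⇒lookup-injective (x∉ ∷ xs!) {zero}  {suc j} eq =
  contradiction eq (All.lookup x∉ (∈-lookup j))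
Unique⇒lookup-injective (x∉ ∷ xs!) {suc i} {zero}  eq =
  contradiction (sym eq) (All.lookup x∉ (∈-lookup i))
Unique⇒lookup-injective (x∉ ∷ xs!) {suc i} {suc j} eq =
  cong suc (Unique⇒lookup-injective xs! eq)

Unique-⊆⇒length≤ : {xs ys : List A} → Unique xs → (∀ {x} → x ∈ˡ xs → x ∈ˡ ys) →
                   length xs ≤ length ys
Unique-⊆⇒length≤ {xs = xs} {ys} xs! xs⊆ys = injective⇒≤ {f = position} position-injective
  where
  position : Fin (length xs) → Fin (length ys)
  position i = Any.index (xs⊆ys (∈-lookup i))

  position-injective : Injective _≡_ _≡_ position
  position-injective {i} {j} eq = Unique⇒lookup-injective xs!
    (trans (Anyₚ.lookup-index (xs⊆ys (∈-lookup i)))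
      (trans (cong (List.lookup ys) eq) (sym (Anyₚ.lookup-index (xs⊆ys (∈-lookup j))))))

length-concatMap-≤ : (f : A → List B) {b : ℕ} → (∀ x → length (f x) ≤ b) →
                     ∀ xs → length (concatMap f xs) ≤ length xs * b
length-concatMap-≤ f f≤b []       = z≤n
length-concatMap-≤ f f≤b (x ∷ xs) = ≤-trans (≤-reflexive (length-++ (f x)))
  (+-mono-≤ (f≤b x) (length-concatMap-≤ f f≤b xs))

length-cartesianProductWith : ∀ {C : Set} (f : A → B → C) xs ys →
  length (cartesianProductWith f xs ys) ≡ length xs * length ys
length-cartesianProductWith f []       ys = refl
length-cartesianProductWith f (x ∷ xs) ys = trans (length-++ (map (f x) ys))
  (cong₂ _+_ (length-map (f x) ys) (length-cartesianProductWith f xs ys))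

lookup-extensional : ∀ {k} {v w : Vec A k} → (∀ i → lookup v i ≡ lookup w i) → v ≡ w
lookup-extensional {v = Vec.[]}    {Vec.[]}    eq = refl
lookup-extensional {v = _ Vec.∷ _} {_ Vec.∷ _} eq = cong₂ Vec._∷_ (eq zero) (lookup-extensional (eq ∘ suc))

length-vectors : (xs : List A) → ∀ k → length (vectors xs k) ≡ length xs ^ k
length-vectors xs zero    = refl
length-vectors xs (suc k) = trans (length-cartesianProductWith Vec._∷_ xs (vectors xs k))
  (cong (length xs *_) (length-vectors xs k))

∈-vectors⁺ : (xs : List A) {k : ℕ} (v : Vec A k) → (∀ i → lookup v i ∈ˡ xs) → v ∈ˡ vectors xs k
∈-vectors⁺ xs Vec.[]      v∈ = here refl
∈-vectors⁺ xs (x Vec.∷ v) v∈ =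
  ∈-cartesianProductWith⁺ Vec._∷_ (v∈ zero) (∈-vectors⁺ xs v (v∈ ∘ suc))

vectors⁺ : {xs : List A} → Unique xs → ∀ k → Unique (vectors xs k)
vectors⁺ xs! zero    = [] ∷ []
vectors⁺ xs! (suc k) = Uniqueₚ.cartesianProductWith⁺ Vec._∷_ ∷-injective xs! (vectors⁺ xs! k)

∈-subsets : (p : Subset n) → p ∈ˡ subsets n
∈-subsets p = ∈-vectors⁺ _ p λ i → ∈-bools (lookup p i)
  where
  ∈-bools : ∀ b → b ∈ˡ true ∷ false ∷ []
  ∈-bools true  = here refl
  ∈-bools false = there (here refl)

subsets⁺ : ∀ n → Unique (subsets n)
subsets⁺ = vectors⁺ (((λ ()) ∷ []) ∷ [] ∷ [])

∈-adjacencies : (E : Adjacency n) → E ∈ˡ adjacencies n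
∈-adjacencies E = ∈-vectors⁺ _ E λ i → ∈-subsets (lookup E i)

candidates⁺ : ∀ n → Unique (candidates n)
candidates⁺ n = Uniqueₚ.cartesianProduct⁺ (subsets⁺ n) (vectors⁺ (subsets⁺ n) n)

∈-candidates : (c : Candidate n) → c ∈ˡ candidates n
∈-candidates (S , E) = ∈-cartesianProduct⁺ (∈-subsets S) (∈-adjacencies E)

-- Embeddings and copies

record IsEmbedding (H : Graph m) (G : Graph n) (f : Fin m → Fin n) : Set where
  field
    injective : Injective _≡_ _≡_ f
    hom       : ∀ u v → Adj H u v → Adj G (f u) (f v)

Embeds : Graph m → Graph n → Set
Embeds H G = ∃ (IsEmbedding H G)

adj? : (G : Graph n) → ∀ u v → Dec (Adj G u v)
adj? G u v = v ∈? lookup (adjacency G) u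

IsEmbedding-∘ : ∀ {k} {F : Graph k} {H : Graph m} {G : Graph n} {f g} →
                IsEmbedding H G g → IsEmbedding F H f → IsEmbedding F G (g ∘ f)
IsEmbedding-∘ g↪ f↪ = record
  { injective = IsEmbedding.injective f↪ ∘ IsEmbedding.injective g↪
  ; hom       = λ u v → IsEmbedding.hom g↪ _ _ ∘ IsEmbedding.hom f↪ u v
  }

module _ (H : Graph m) (f : Fin m → Fin n) where

  Image : Pred (Fin n) 0ℓ
  Image v = ∃ λ u → f u ≡ v

  image? : Decidable Image
  image? v = any? λ u → f u ≟ᶠ v

  EdgeImage : Fin n → Pred (Fin n) 0ℓ
  EdgeImage a b = ∃₂ λ u v → Adj H u v × f u ≡ a × f v ≡ b

  edgeImage? : ∀ a → Decidable (EdgeImage a)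
  edgeImage? a b = any? λ u → any? λ v → adj? H u v ×-dec (f u ≟ᶠ a) ×-dec (f v ≟ᶠ b)

  imageOf : Candidate n
  imageOf = comprehension image? , Vec.tabulate (comprehension ∘ edgeImage?)

  Edge-imageOf⁺ : ∀ {a b} → EdgeImage a b → Edge (proj₂ imageOf) a b
  Edge-imageOf⁺ {a} {b} e = subst (b ∈_) (sym (lookup∘tabulate _ a))
    (∈-comprehension⁺ (edgeImage? a) e)

  Edge-imageOf⁻ : ∀ {a b} → Edge (proj₂ imageOf) a b → EdgeImage a b
  Edge-imageOf⁻ {a} {b} e = ∈-comprehension⁻ (edgeImage? a)
    (subst (b ∈_) (lookup∘tabulate _ a) e)

IsCopy-imageOf : {H : Graph m} {G : Graph n} {f : Fin m → Fin n} →
                 IsEmbedding H G f → IsCopy H G (imageOf H f)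
IsCopy-imageOf {H = H} {G} {f} f↪ = subgraph , f , isomorphism
  where
  open IsEmbedding f↪

  subgraph : IsSubgraph G _ _
  subgraph = mkIsSubgraph
    (λ e → let u , v , uv , fu , fv = Edge-imageOf⁻ H f e
           in Edge-imageOf⁺ H f (v , u , Graph.symmetric H uv , fv , fu))
    (λ a b e → let u , v , uv , fu , fv = Edge-imageOf⁻ H f e
               in ∈-comprehension⁺ (image? H f) (u , fu))
    (λ a b e → let u , v , uv , fu , fv = Edge-imageOf⁻ H f e
               in subst₂ (Adj G) fu fv (hom u v uv))

  isomorphism : IsIsomorphism H _ _ f
  isomorphism = mkIsIsomorphism injective
    (λ v → mk⇔ (∈-comprehension⁻ (image? H f)) (∈-comprehension⁺ (image? H f)))
    (λ u v → mk⇔ (λ uv → Edge-imageOf⁺ H f (u , v , uv , refl , refl))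
      (λ e → let u′ , v′ , uv , fu , fv = Edge-imageOf⁻ H f e
             in subst₂ (Adj H) (injective fu) (injective fv) uv))

-- The candidate is recovered from every map pointwise equal to `f`: without function
-- extensionality, a list of maps can be complete only up to `≗`.
IsCopy⇒embedding : {H : Graph m} {G : Graph n} {c : Candidate n} → IsCopy H G c →
  ∃ λ f → IsEmbedding H G f × ∀ {g} → f ≗ g → c ≡ imageOf H g
IsCopy⇒embedding {H = H} {G} {S , E}
  (mkIsSubgraph symmetric endpoints edges , f , mkIsIsomorphism inj im iso) =
  f , record { injective = inj ; hom = λ u v uv → edges _ _ (Equivalence.to (iso u v) uv) } , unique
  where
  unique : ∀ {g} → f ≗ g → (S , E) ≡ imageOf H g
  unique {g} f≗g = cong₂ _,_
    (⊆-antisym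
      (λ v∈S → let u , fu = Equivalence.to (im _) v∈S
               in ∈-comprehension⁺ (image? H g) (u , trans (sym (f≗g u)) fu))
      (λ v∈ → let u , gu = ∈-comprehension⁻ (image? H g) v∈
              in Equivalence.from (im _) (u , trans (f≗g u) gu)))
    (lookup-extensional λ a → trans (⊆-antisym (sub a) (sup a)) (sym (lookup∘tabulate _ a)))
    where
    sub : ∀ a → lookup E a ⊆ comprehension (edgeImage? H g a)
    sub a {b} e =
      let u , fu = Equivalence.to (im a) (endpoints a b e)
          v , fv = Equivalence.to (im b) (endpoints b a (symmetric e))
      in ∈-comprehension⁺ (edgeImage? H g a)
           (u , v , Equivalence.from (iso u v) (subst₂ (Edge E) (sym fu) (sym fv) e)
           , trans (sym (f≗g u)) fu , trans (sym (f≗g v)) fv)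

    sup : ∀ a → comprehension (edgeImage? H g a) ⊆ lookup E a
    sup a {b} b∈ =
      let u , v , uv , gu , gv = ∈-comprehension⁻ (edgeImage? H g a) b∈
      in subst₂ (Edge E) (trans (f≗g u) gu) (trans (f≗g v) gv) (Equivalence.to (iso u v) uv)


module _ (G : Graph m) (ι : Fin n → Fin m) where

  private
    edge? : ∀ a → Decidable (λ b → Adj G (ι a) (ι b))
    edge? a b = adj? G (ι a) (ι b)

    E : Adjacency n
    E = Vec.tabulate (comprehension ∘ edge?)

    Edge⁺ : ∀ {a b} → Adj G (ι a) (ι b) → Edge E a b
    Edge⁺ {a} {b} e = subst (b ∈_) (sym (lookup∘tabulate _ a)) (∈-comprehension⁺ (edge? a) e)

    Edge⁻ : ∀ {a b} → Edge E a b → Adj G (ι a) (ι b)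
    Edge⁻ {a} {b} e = ∈-comprehension⁻ (edge? a) (subst (b ∈_) (lookup∘tabulate _ a) e)

  induced : Graph n
  induced = record
    { adjacency = E
    ; isSimple  = record
      { symmetric   = λ e → Edge⁺ (Graph.symmetric G (Edge⁻ e))
      ; irreflexive = λ { refl e → Graph.irreflexive G refl (Edge⁻ e) }
      }
    }

  induced⁺ : ∀ {a b} → Adj G (ι a) (ι b) → Adj induced a b
  induced⁺ = Edge⁺

  IsEmbedding-induced : Injective _≡_ _≡_ ι → IsEmbedding induced G ι
  IsEmbedding-induced inj = record { injective = inj ; hom = λ _ _ → Edge⁻ }

Contains⇒Embeds : {G : Graph n} {H : Graph m} → Contains G H → Embeds H G
Contains⇒Embeds (_ , c) = let f , f↪ , _ = IsCopy⇒embedding c in f , f↪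

Free-antitone : {ℱ : Family ℓ} {G : Graph n} {G′ : Graph m} →
                Embeds G′ G → Free ℱ G → Free ℱ G′
Free-antitone (g , g↪) free H H∈ℱ H⊆G′ =
  let f , f↪ = Contains⇒Embeds H⊆G′
  in free H H∈ℱ (_ , IsCopy-imageOf (IsEmbedding-∘ g↪ f↪))

#copies-≤ : (H : Graph m) (G : Graph n) (fs : List (Fin m → Fin n)) →
            (∀ f → IsEmbedding H G f → Any (f ≗_) fs) → #copies H G ≤ length fs
#copies-≤ H G fs complete = ≤-trans
  (Unique-⊆⇒length≤ (Uniqueₚ.filter⁺ (isCopy? H G) (candidates⁺ _)) λ c∈ →
    let f , f↪ , unique = IsCopy⇒embedding (proj₂ (∈-filter⁻ (isCopy? H G) {xs = candidates _} c∈))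
    in Anyₚ.map⁺ (Any.map unique (complete f f↪)))
  (≤-reflexive (length-map (imageOf H) fs))

≤-#copies : (H : Graph m) (G : Graph n) {cs : List (Candidate n)} → Unique cs →
            (∀ {c} → c ∈ˡ cs → ∃ λ f → IsEmbedding H G f × c ≡ imageOf H f) →
            length cs ≤ #copies H G
≤-#copies H G cs! images = Unique-⊆⇒length≤ cs! λ c∈ →
  let f , f↪ , c≡ = images c∈
  in ∈-filter⁺ (isCopy? H G) (∈-candidates _) (subst (IsCopy H G) (sym c≡) (IsCopy-imageOf f↪))

-- Two proofs of `IsSimple` for one adjacency need not be equal, so only the adjacency of `G` is
-- sure to occur in the list.
graphs-complete : (G : Graph n) → Any (λ G′ → adjacency G′ ≡ adjacency G) (graphs n)
graphs-complete {n} G = Anyₚ.mapMaybe⁺ toGraph (adjacencies n)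
  (Anyₚ.map⁺ (Any.map (λ { refl → toGraph-just (adjacency G) (Graph.isSimple G) })
    (∈-adjacencies (adjacency G))))
  where
  toGraph-just : ∀ A → IsSimple A → MaybeAny.Any (λ G′ → adjacency G′ ≡ A) (toGraph A)
  toGraph-just A simple with isSimple? A
  ... | yes _ = MaybeAny.just refl
  ... | no ¬p = contradiction simple ¬p

module _ (em : ExcludedMiddle ℓ) (T : Graph t) (ℱ : Family ℓ) where

  ex-≤ : ∀ {N} → (∀ (G : Graph n) → Free ℱ G → #copies T G ≤ N) → ex em n T ℱ ≤ N
  ex-≤ bound = max≤v⁺ z≤n (Allₚ.map⁺ (All.tabulate λ {G} G∈ →
    bound G (proj₂ (∈-filter⁻ (λ G → em {Free ℱ G}) {xs = graphs _} G∈))))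

  ≤-ex : (G : Graph n) → Free ℱ G → {cs : List (Candidate n)} → Unique cs →
         (∀ {c} → c ∈ˡ cs → ∃ λ f → IsEmbedding T G f × c ≡ imageOf T f) →
         length cs ≤ ex em n T ℱ
  ≤-ex {n} G free {cs} cs! images =
    let G′ , G′∈ , G′≡G = find (graphs-complete G)
        transport : ∀ {k} {H : Graph k} {f} → IsEmbedding H G f → IsEmbedding H G′ f
        transport {f = f} f↪ = record
          { injective = IsEmbedding.injective f↪
          ; hom       = λ u v uv →
              subst (λ A → Edge A (f u) (f v)) (sym G′≡G) (IsEmbedding.hom f↪ u v uv)
          }
        G′↪G : IsEmbedding G′ G id
        G′↪G = record { injective = id ; hom = λ u v → subst (λ A → Edge A u v) G′≡G }
        G′∈free = ∈-filter⁺ (λ G → em {Free ℱ G}) G′∈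
          (Free-antitone {ℱ = ℱ} {G = G} {G′} (id , G′↪G) free)
    in v≤max⁺ 0 _ (inj₂ (Anyₚ.map⁺ (lose G′∈free (≤-#copies T G′ cs! λ c∈ →
         let f , f↪ , c≡ = images c∈ in f , transport f↪ , c≡))))

-- Forests and sparse graphs

module _ (G : Graph n) (acyclic : IsForest G) (x : ℕ → Fin n)
         (adj : ∀ i → Adj G (x i) (x (suc i))) (turn : ∀ i → x (2 + i) ≢ x i) where

  private
    -- The first repetition along the walk would close a cycle, hence induction on the gap.
    distinct : ∀ d i → x i ≢ x (i + suc d)
    distinct = <-rec (λ d → ∀ i → x i ≢ x (i + suc d)) step
      where
      step : ∀ d → (∀ {e} → e < d → ∀ i → x i ≢ x (i + suc e)) → ∀ i → x i ≢ x (i + suc d)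
      -- Gaps of one and two steps are too short for a `Cycle`; they are excluded by irreflexivity
      -- and by `turn`.
      step 0 rec i eq = Graph.irreflexive G (trans eq (cong x (+-comm i 1))) (adj i)
      step 1 rec i eq = turn i (sym (trans eq (cong x (+-comm i 2))))
      step (suc (suc e)) rec i eq = acyclic (record
        { vertex    = vertex
        ; injective = injective
        ; steps     = λ j → subst₂ (Adj G)
            (cong (λ k → x (i + k)) (sym (toℕ-inject₁ j))) (cong x (sym (+-suc i (toℕ j))))
            (adj (i + toℕ j))
        ; closes    = subst₂ (Adj G)
            (cong (λ k → x (i + k)) (sym (toℕ-fromℕ (2 + e))))
            (trans (cong x (sym (+-suc i (2 + e)))) (trans (sym eq) (cong x (sym (+-identityʳ i)))))
            (adj (i + (2 + e)))
        })
        where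
        vertex : Fin (3 + e) → Fin _
        vertex j = x (i + toℕ j)

        apart : ∀ {j k : Fin (3 + e)} → toℕ j < toℕ k → vertex j ≢ vertex k
        apart {j} {k} j<k vj≡vk = rec
          (≤-trans (s≤s (m∸n≤m (pred (toℕ k)) (toℕ j)))
            (≤-trans (≤-reflexive (suc-pred (toℕ k) {{>-nonZero (≤-<-trans z≤n j<k)}})) (s≤s⁻¹ (toℕ<n k))))
          (i + toℕ j)
          (trans vj≡vk (cong x (begin
            i + toℕ k                                   ≡⟨ cong (i +_) (m+[n∸m]≡n j<k) ⟨
            i + (suc (toℕ j) + (toℕ k ∸ suc (toℕ j)))   ≡⟨ cong (i +_) (+-suc (toℕ j) _) ⟨
            i + (toℕ j + suc (toℕ k ∸ suc (toℕ j)))     ≡⟨ +-assoc i _ _ ⟨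
            i + toℕ j + suc (toℕ k ∸ suc (toℕ j))       ≡⟨ cong (λ l → i + toℕ j + suc l) (pred-∸ (toℕ k) (toℕ j)) ⟩
            i + toℕ j + suc (pred (toℕ k) ∸ toℕ j)      ∎)))
          where
          open ≡-Reasoning
          pred-∸ : ∀ a b → a ∸ suc b ≡ pred a ∸ b
          pred-∸ zero    b = sym (0∸n≡0 b)
          pred-∸ (suc a) b = refl

        injective : Injective _≡_ _≡_ vertex
        injective {j} {k} eq with <-cmp (toℕ j) (toℕ k)
        ... | tri< j<k _ _ = contradiction eq (apart j<k)
        ... | tri≈ _ j≡k _ = toℕ-injective j≡k
        ... | tri> _ _ k<j = contradiction (sym eq) (apart k<j)

  walk-injective : Injective _≡_ _≡_ x
  walk-injective {i} {j} eq with <-cmp i j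
  ... | tri≈ _ i≡j _ = i≡j
  ... | tri< i<j _ _ = contradiction (trans eq (cong x (sym (trans (+-suc i _) (m+[n∸m]≡n i<j)))))
                         (distinct (j ∸ suc i) i)
  ... | tri> _ _ j<i = contradiction (trans (sym eq) (cong x (sym (trans (+-suc j _) (m+[n∸m]≡n j<i)))))
                         (distinct (i ∸ suc j) j)

-- `p` need not be a neighbour of `v`, so isolated vertices count as leaves.
Leaf : Graph n → Subset n → Pred (Fin n) 0ℓ
Leaf G W v = ∃ λ p → ∀ y → y ∈ W → Adj G v y → y ≡ p

-- Without a leaf, a walk in `W` can always move on to a vertex other than the one it came from. It
-- would run forever and be injective, yet `Fin n` is finite.
forest⇒leaf : (G : Graph n) → IsForest G → (W : Subset n) → ∃ (_∈ W) → ∃ λ v → v ∈ W × Leaf G W v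
forest⇒leaf {n} G acyclic W (w , w∈W)
  with any? (λ v → (v ∈? W) ×-dec any? λ p → all? λ y → (y ∈? W) →-dec (adj? G v y →-dec (y ≟ᶠ p)))
... | yes leaf   = leaf
... | no no-leaf = ⊥-elim (ℕ→Fin-notInjective x
  (walk-injective G acyclic x
    (λ i → let _ , v , v∈W = walk i in proj₁ (proj₂ (proj₂ (next _ v v∈W))))
    (λ i → let _ , v , v∈W = walk (suc i) in proj₂ (proj₂ (proj₂ (next _ v v∈W))))))
  where
  next : ∀ p v → v ∈ W → ∃ λ y → y ∈ W × Adj G v y × y ≢ p
  next p v v∈W with any? (λ y → (y ∈? W) ×-dec adj? G v y ×-dec ¬? (y ≟ᶠ p))
  ... | yes found = found
  ... | no ¬found = ⊥-elim (no-leaf (v , v∈W , p , λ y y∈W vy →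
          decidable-stable (y ≟ᶠ p) λ y≢p → ¬found (y , y∈W , vy , y≢p)))

  walk : ℕ → ∃₂ λ (p v : Fin n) → v ∈ W
  walk zero    = w , w , w∈W
  walk (suc i) = let p , v , v∈W = walk i
                     y , y∈W , _ = next p v v∈W
                 in v , y , y∈W

  x : ℕ → Fin n
  x i = proj₁ (proj₂ (walk i))

-- An ordering that witnesses 1-degeneracy. The only earlier neighbour of a vertex will be its
-- parent, so a rooted forest arises without any choice of roots.
record Ranking (G : Graph n) (W : Subset n) : Set where
  field
    rank           : Fin n → ℕ
    rank<          : ∀ {v} → v ∈ W → rank v < ∣ W ∣
    rank-injective : ∀ {u v} → u ∈ W → v ∈ W → rank u ≡ rank v → u ≡ v
    earlier-unique : ∀ {u u′ v} → u ∈ W → u′ ∈ W → v ∈ W → Adj G u v → Adj G u′ v →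
                     rank u < rank v → rank u′ < rank v → u ≡ u′

module _ {G : Graph n} {W : Subset n} {v : Fin n} (v∈W : v ∈ W) (leaf : Leaf G W v)
         (R : Ranking G (W - v)) where

  private
    module R = Ranking R

    W′ = W - v

    rank : Fin n → ℕ
    rank = updateAt R.rank v (λ _ → ∣ W′ ∣)

    rank-v : rank v ≡ ∣ W′ ∣
    rank-v = updateAt-updates v R.rank

    rank-≢ : ∀ {x} → x ≢ v → rank x ≡ R.rank x
    rank-≢ {x} x≢v = updateAt-minimal x v R.rank x≢v

    rest : ∀ {x} → x ∈ W → x ≢ v → x ∈ W′
    rest = x∈p∧x≢y⇒x∈p-y

    rank-<v : ∀ {x} → x ∈ W → x ≢ v → rank x < rank v
    rank-<v x∈W x≢v = subst₂ _<_ (sym (rank-≢ x≢v)) (sym rank-v) (R.rank< (rest x∈W x≢v))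

  -- The leaf is ranked last: it is then earlier than nothing, and all its neighbours in `W`
  -- coincide.
  addLeaf : Ranking G W
  addLeaf = record
    { rank           = rank
    ; rank<          = bound
    ; rank-injective = injective
    ; earlier-unique = unique
    }
    where
    rank-v< : rank v < ∣ W ∣
    rank-v< = subst (_< ∣ W ∣) (sym rank-v) (x∈p⇒∣p-x∣<∣p∣ v∈W)

    bound : ∀ {x} → x ∈ W → rank x < ∣ W ∣
    bound {x} x∈W with x ≟ᶠ v
    ... | yes refl = rank-v<
    ... | no x≢v   = <-trans (rank-<v x∈W x≢v) rank-v<

    injective : ∀ {x y} → x ∈ W → y ∈ W → rank x ≡ rank y → x ≡ y
    injective {x} {y} x∈W y∈W eq with x ≟ᶠ v | y ≟ᶠ v
    ... | yes refl | yes refl = refl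
    ... | yes refl | no y≢v   = contradiction (sym eq) (<⇒≢ (rank-<v y∈W y≢v))
    ... | no x≢v   | yes refl = contradiction eq (<⇒≢ (rank-<v x∈W x≢v))
    ... | no x≢v   | no y≢v   = R.rank-injective (rest x∈W x≢v) (rest y∈W y≢v)
                                  (trans (sym (rank-≢ x≢v)) (trans eq (rank-≢ y≢v)))

    unique : ∀ {x x′ y} → x ∈ W → x′ ∈ W → y ∈ W → Adj G x y → Adj G x′ y →
             rank x < rank y → rank x′ < rank y → x ≡ x′
    unique {x} {x′} {y} x∈W x′∈W y∈W xy x′y x<y x′<y with y ≟ᶠ v
    ... | yes refl = trans (proj₂ leaf x x∈W (Graph.symmetric G xy))
                           (sym (proj₂ leaf x′ x′∈W (Graph.symmetric G x′y)))
    ... | no y≢v = R.earlier-unique (rest x∈W (earlier≢v x<y)) (rest x′∈W (earlier≢v x′<y))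
                     (rest y∈W y≢v) xy x′y (unchanged x<y) (unchanged x′<y)
      where
      earlier≢v : ∀ {z} → rank z < rank y → z ≢ v
      earlier≢v z<y refl = <-asym z<y (rank-<v y∈W y≢v)

      unchanged : ∀ {z} → rank z < rank y → R.rank z < R.rank y
      unchanged z<y = subst₂ _<_ (rank-≢ (earlier≢v z<y)) (rank-≢ y≢v) z<y

forest⇒ranking : (G : Graph n) → IsForest G → ∀ d W → ∣ W ∣ ≤ d → Ranking G W
forest⇒ranking G acyclic d W W≤d with nonempty? W
... | no ¬W = record
  { rank           = λ _ → 0
  ; rank<          = λ v∈W → contradiction (_ , v∈W) ¬W
  ; rank-injective = λ u∈W → contradiction (_ , u∈W) ¬W
  ; earlier-unique = λ u∈W → contradiction (_ , u∈W) ¬W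
  }
forest⇒ranking G acyclic zero W W≤d | yes (w , w∈W) =
  contradiction (<-≤-trans (x∈p⇒∣p-x∣<∣p∣ w∈W) W≤d) n≮0
forest⇒ranking G acyclic (suc d) W W≤d | yes W≠∅ =
  let v , v∈W , leaf = forest⇒leaf G acyclic W W≠∅
  in addLeaf v∈W leaf (forest⇒ranking G acyclic d (W - v)
       (s≤s⁻¹ (≤-trans (x∈p⇒∣p-x∣<∣p∣ v∈W) W≤d)))

-- A root is its own parent.
record Elimination (G : Graph n) : Set where
  field
    rank           : Fin n → ℕ
    rank<          : ∀ v → rank v < n
    rank-injective : Injective _≡_ _≡_ rank
    parent         : Fin n → Fin n
    parent-adj     : ∀ v → parent v ≡ v ⊎ Adj G (parent v) v
    earlier⇒parent : ∀ {u v} → Adj G u v → rank u < rank v → u ≡ parent v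

forest⇒elimination : (G : Graph n) → IsForest G → Elimination G
forest⇒elimination {n} G acyclic = record
  { rank           = rank
  ; rank<          = λ v → subst (rank v <_) (∣⊤∣≡n n) (R.rank< ∈⊤)
  ; rank-injective = R.rank-injective ∈⊤ ∈⊤
  ; parent         = parent
  ; parent-adj     = parent-adj
  ; earlier⇒parent = earlier⇒parent
  }
  where
  module R = Ranking (forest⇒ranking G acyclic _ ⊤ ≤-refl)
  open R using (rank)

  earlier? : ∀ v → Dec (∃ λ u → Adj G u v × rank u < rank v)
  earlier? v = any? λ u → adj? G u v ×-dec (rank u <? rank v)

  parent : Fin n → Fin n
  parent v with earlier? v
  ... | yes (u , _) = u
  ... | no _        = v

  parent-adj : ∀ v → parent v ≡ v ⊎ Adj G (parent v) v
  parent-adj v with earlier? v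
  ... | yes (u , uv , _) = inj₂ uv
  ... | no _             = inj₁ refl

  earlier⇒parent : ∀ {u v} → Adj G u v → rank u < rank v → u ≡ parent v
  earlier⇒parent {u} {v} uv u<v with earlier? v
  ... | yes (u′ , u′v , u′<v) = R.earlier-unique ∈⊤ ∈⊤ ∈⊤ uv u′v u<v u′<v
  ... | no ¬earlier           = contradiction (u , uv , u<v) ¬earlier

module _ {F : Graph m} (elim : Elimination F) {G : Graph n} {W : Subset n} {w : Fin n} (w∈W : w ∈ W)
         (dense : ∀ {x} → x ∈ W → ∀ ys → length ys ≤ m → ∃ λ y → y ∈ W × Adj G x y × y ∉ˡ ys)
         where

  open Elimination elim

  -- A partial embedding kept as a total map; the values at ranks `j` and above are junk.
  record EmbedsBelow (j : ℕ) (f : Fin m → Fin n) : Set where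
    field
      inside    : ∀ {u} → rank u < j → f u ∈ W
      injective : ∀ {u v} → rank u < j → rank v < j → f u ≡ f v → u ≡ v
      hom       : ∀ {u v} → rank u < j → rank v < j → Adj F u v → Adj G (f u) (f v)

  private
    extend : ∀ {j f v} → rank v ≡ j → EmbedsBelow j f → ∃ (EmbedsBelow (suc j))
    extend {j} {f} {v} refl E = f′ , record { inside = inside′ ; injective = injective′ ; hom = hom′ }
      where
      open EmbedsBelow E

      -- A root has no placed parent to be attached to, so `w` stands in for one.
      base : ∃ λ x → x ∈ W × (rank (parent v) < rank v → x ≡ f (parent v))
      base with rank (parent v) <? rank v
      ... | yes p<v = f (parent v) , inside p<v , λ _ → refl
      ... | no p≮v  = w , w∈W , λ p<v → contradiction p<v p≮v

      -- Avoiding all values of `f`, junk included, still forbids only `m` vertices, which is the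
      -- bound in `dense`.
      fresh : ∃ λ y → y ∈ W × Adj G (proj₁ base) y × y ∉ˡ tabulate f
      fresh = dense (proj₁ (proj₂ base)) (tabulate f) (≤-reflexive (length-tabulate f))

      y = proj₁ fresh

      f′ : Fin m → Fin n
      f′ = updateAt f v (λ _ → y)

      f′-v : f′ v ≡ y
      f′-v = updateAt-updates v f

      f′-≢ : ∀ {u} → u ≢ v → f′ u ≡ f u
      f′-≢ {u} = updateAt-minimal u v f

      y≢f : ∀ u → y ≢ f u
      y≢f u eq = proj₂ (proj₂ (proj₂ fresh)) (subst (_∈ˡ tabulate f) (sym eq) (∈-tabulate⁺ u))

      earlier : ∀ {u} → rank u < suc (rank v) → u ≢ v → rank u < rank v
      earlier u≤v u≢v = ≤∧≢⇒< (s≤s⁻¹ u≤v) (u≢v ∘ rank-injective)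

      inside′ : ∀ {u} → rank u < suc (rank v) → f′ u ∈ W
      inside′ {u} u≤v with u ≟ᶠ v
      ... | yes refl = subst (_∈ W) (sym f′-v) (proj₁ (proj₂ fresh))
      ... | no u≢v   = subst (_∈ W) (sym (f′-≢ u≢v)) (inside (earlier u≤v u≢v))

      injective′ : ∀ {a b} → rank a < suc (rank v) → rank b < suc (rank v) → f′ a ≡ f′ b → a ≡ b
      injective′ {a} {b} a≤v b≤v eq with a ≟ᶠ v | b ≟ᶠ v
      ... | yes refl | yes refl = refl
      ... | yes refl | no b≢v   = contradiction (trans (sym f′-v) (trans eq (f′-≢ b≢v))) (y≢f b)
      ... | no a≢v   | yes refl = contradiction (trans (sym f′-v) (trans (sym eq) (f′-≢ a≢v))) (y≢f a)
      ... | no a≢v   | no b≢v   = injective (earlier a≤v a≢v) (earlier b≤v b≢v)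
                                    (trans (sym (f′-≢ a≢v)) (trans eq (f′-≢ b≢v)))

      hom-v : ∀ {u} → rank u < rank v → Adj F u v → Adj G (f u) y
      hom-v {u} u<v uv = subst (λ x → Adj G x y)
        (trans (proj₂ (proj₂ base) (subst (λ p → rank p < rank v) u≡p u<v)) (cong f (sym u≡p)))
        (proj₁ (proj₂ (proj₂ fresh)))
        where u≡p = earlier⇒parent uv u<v

      hom′ : ∀ {a b} → rank a < suc (rank v) → rank b < suc (rank v) → Adj F a b → Adj G (f′ a) (f′ b)
      hom′ {a} {b} a≤v b≤v ab with a ≟ᶠ v | b ≟ᶠ v
      ... | yes refl | yes refl = ⊥-elim (Graph.irreflexive F refl ab)
      ... | yes refl | no b≢v   = subst₂ (Adj G) (sym f′-v) (sym (f′-≢ b≢v))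
                                    (Graph.symmetric G (hom-v (earlier b≤v b≢v) (Graph.symmetric F ab)))
      ... | no a≢v   | yes refl = subst₂ (Adj G) (sym (f′-≢ a≢v)) (sym f′-v) (hom-v (earlier a≤v a≢v) ab)
      ... | no a≢v   | no b≢v   = subst₂ (Adj G) (sym (f′-≢ a≢v)) (sym (f′-≢ b≢v))
                                    (hom (earlier a≤v a≢v) (earlier b≤v b≢v) ab)

    embedsBelow : ∀ j → ∃ (EmbedsBelow j)
    embedsBelow zero    = (λ _ → w) , record { inside = λ () ; injective = λ () ; hom = λ () }
    embedsBelow (suc j) with embedsBelow j | any? (λ v → rank v ≟ j)
    ... | f , E | yes (v , v≡j) = extend v≡j E
    -- A rank that no vertex takes is skipped, which spares a proof that `rank` is surjective.
    ... | f , E | no ¬v         = f , record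
      { inside    = λ u≤j → inside (drop u≤j)
      ; injective = λ u≤j v≤j → injective (drop u≤j) (drop v≤j)
      ; hom       = λ u≤j v≤j → hom (drop u≤j) (drop v≤j)
      }
      where
      open EmbedsBelow E
      drop : ∀ {u} → rank u < suc j → rank u < j
      drop u≤j = ≤∧≢⇒< (s≤s⁻¹ u≤j) (λ u≡j → ¬v (_ , u≡j))

  dense⇒embeds : Embeds F G
  dense⇒embeds = let f , E = embedsBelow m in f , record
    { injective = EmbedsBelow.injective E (rank< _) (rank< _)
    ; hom       = λ u v → EmbedsBelow.hom E (rank< u) (rank< v)
    }

module _ (em : ExcludedMiddle 0ℓ) {F : Graph m} (elim : Elimination F)
         {G : Graph n} (F⊈G : ¬ Embeds F G) where

  FewNeighbours : Subset n → Pred (Fin n) 0ℓ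
  FewNeighbours W x = ∃ λ ys → length ys ≤ m × (∀ {y} → y ∈ W → Adj G x y → y ∈ˡ ys)

  -- Otherwise every vertex of `W` has a neighbour in `W` outside any given `m` vertices, and `F`
  -- embeds greedily along its ranking, each vertex next to its parent.
  sparse : ∀ {W w} → w ∈ W → ∃ λ x → x ∈ W × FewNeighbours W x
  sparse {W} w∈W with em {∃ λ x → x ∈ W × FewNeighbours W x}
  ... | yes found = found
  ... | no ¬found = ⊥-elim (F⊈G (dense⇒embeds elim {W = W} w∈W dense))
    where
    dense : ∀ {x} → x ∈ W → ∀ ys → length ys ≤ m → ∃ λ y → y ∈ W × Adj G x y × y ∉ˡ ys
    dense {x} x∈W ys ys≤m with em {∃ λ y → y ∈ W × Adj G x y × y ∉ˡ ys}
    ... | yes fresh = fresh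
    ... | no ¬fresh = ⊥-elim (¬found (x , x∈W , ys , ys≤m , λ {y} y∈W xy →
            decidable-stable em λ y∉ys → ¬fresh (y , y∈W , xy , y∉ys)))

  -- Sparse vertices are peeled off one by one. Each accounts for at most `m` edges in the remaining
  -- graph, listed in both orientations, hence `m + m`.
  edgeList : ∀ d W → ∣ W ∣ ≤ d → ∃ λ (ps : List (Fin n × Fin n)) →
             length ps ≤ d * (m + m) × (∀ {u v} → u ∈ W → v ∈ W → Adj G u v → (u , v) ∈ˡ ps)
  edgeList d W W≤d with nonempty? W
  ... | no ¬W = [] , z≤n , λ u∈W → contradiction (_ , u∈W) ¬W
  edgeList zero W W≤d | yes (w , w∈W) =
    contradiction (<-≤-trans (x∈p⇒∣p-x∣<∣p∣ w∈W) W≤d) n≮0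
  edgeList (suc d) W W≤d | yes (w , w∈W) =
    let x , x∈W , ys , ys≤m , nbrs = sparse w∈W
        ps , ps≤ , edges = edgeList d (W - x) (s≤s⁻¹ (≤-trans (x∈p⇒∣p-x∣<∣p∣ x∈W) W≤d))
    in map (x ,_) ys ++ map (_, x) ys ++ ps
     , (begin
         length (map (x ,_) ys ++ map (_, x) ys ++ ps)
           ≡⟨ length-++ (map (x ,_) ys) ⟩
         length (map (x ,_) ys) + length (map (_, x) ys ++ ps)
           ≡⟨ cong₂ _+_ (length-map (x ,_) ys) (length-++ (map (_, x) ys)) ⟩
         length ys + (length (map (_, x) ys) + length ps)
           ≡⟨ cong (λ l → length ys + (l + length ps)) (length-map (_, x) ys) ⟩
         length ys + (length ys + length ps)
           ≤⟨ +-mono-≤ ys≤m (+-mono-≤ ys≤m ps≤) ⟩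
         m + (m + d * (m + m))
           ≡⟨ +-assoc m m _ ⟨
         m + m + d * (m + m) ∎)
     , λ {u} {v} u∈W v∈W uv → case (u ≟ᶠ x) of λ where
         (yes refl) → ∈-++⁺ˡ (∈-map⁺ (x ,_) (nbrs v∈W uv))
         (no u≢x)   → ∈-++⁺ʳ (map (x ,_) ys) (case (v ≟ᶠ x) of λ where
           (yes refl) → ∈-++⁺ˡ (∈-map⁺ (_, x) (nbrs u∈W (Graph.symmetric G uv)))
           (no v≢x)   → ∈-++⁺ʳ (map (_, x) ys)
                          (edges (x∈p∧x≢y⇒x∈p-y u∈W u≢x) (x∈p∧x≢y⇒x∈p-y v∈W v≢x) uv))
    where open ≤-Reasoning

-- Packing and piercing subtrees

least : ExcludedMiddle 0ℓ → {A : Set} (P : Pred A 0ℓ) (f : A → ℕ) → ∃ P →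
        ∃ λ x → P x × ∀ {y} → P y → f x ≤ f y
least em P f (x , px) = <-rec (λ k → ∀ x → P x → f x ≡ k → ∃ λ x → P x × ∀ {y} → P y → f x ≤ f y)
  step (f x) x px refl
  where
  step : ∀ k → (∀ {j} → j < k → ∀ x → P x → f x ≡ j → ∃ λ x → P x × ∀ {y} → P y → f x ≤ f y) →
         ∀ x → P x → f x ≡ k → ∃ λ x → P x × ∀ {y} → P y → f x ≤ f y
  step _ rec x px refl with em {∃ λ y → P y × f y < f x}
  ... | yes (y , py , y<x) = rec y<x y py refl
  ... | no ¬smaller        = x , px , λ py → ≮⇒≥ λ y<x → ¬smaller (_ , py , y<x)

Apart : Graph t → Subset t → Subset t → Set
Apart T C D = ∀ {x y} → x ∈ C → y ∈ D → x ≢ y × ¬ Adj T x y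

module Subtrees {T : Graph t} (elim : Elimination T) where

  open Elimination elim

  -- Connectedness is expressed by climbing: from any vertex of `C`, parents stay in `C` and lose
  -- rank until `top` is reached. This replaces paths by induction on the rank.
  record IsSubtree (C : Subset t) (top : Fin t) : Set where
    field
      top∈      : top ∈ C
      top-least : ∀ {x} → x ∈ C → rank top ≤ rank x
      closed    : ∀ {x} → x ∈ C → x ≢ top → parent x ∈ C × rank (parent x) < rank x

  -- The piercing object is the edge from `z` to its parent, which degenerates to a vertex when `z`
  -- is a root.
  Pierces : Fin t → Subset t → Set
  Pierces z C = z ∈ C ⊎ parent z ∈ C

  module _ {C D : Subset t} {v u : Fin t} (Cv : IsSubtree C v) (Du : IsSubtree D u)
           (u≤v : rank u ≤ rank v) where

    private
      module C = IsSubtree Cv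
      module D = IsSubtree Du

      -- Climbing from `x` reaches `v` before it can leave `D`: no vertex of `C` has smaller rank
      -- than `v`, and the rank of `u` is no larger than that of `v`.
      meet⇒top∈ : ∀ {x} → x ∈ C → x ∈ D → v ∈ D
      meet⇒top∈ {x} = <-rec (λ k → ∀ x → rank x ≡ k → x ∈ C → x ∈ D → v ∈ D) step (rank x) x refl
        where
        step : ∀ k → (∀ {j} → j < k → ∀ x → rank x ≡ j → x ∈ C → x ∈ D → v ∈ D) →
               ∀ x → rank x ≡ k → x ∈ C → x ∈ D → v ∈ D
        step _ rec x refl x∈C x∈D with x ≟ᶠ v
        ... | yes refl = x∈D
        ... | no x≢v   =
          let px∈C , px<x = C.closed x∈C x≢v
              px∈D , _    = D.closed x∈D λ { refl →
                              x≢v (rank-injective (≤-antisym u≤v (C.top-least x∈C))) }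
          in rec px<x (parent x) refl px∈C px∈D

    -- The Helly-type step: the later of two tops pierces both of two touching subtrees. The earlier
    -- end of an edge is the parent of the other end, and it lies in both subtrees, except when the
    -- edge leaves `C` from `v` to its parent; then the parent pierces `D`.
    touch⇒pierces : ∀ {x y} → x ∈ C → y ∈ D → x ≡ y ⊎ Adj T x y → Pierces v D
    touch⇒pierces x∈C y∈D (inj₁ refl) = inj₁ (meet⇒top∈ x∈C y∈D)
    touch⇒pierces {x} {y} x∈C y∈D (inj₂ xy) with <-cmp (rank x) (rank y)
    ... | tri≈ _ x≡y _ = ⊥-elim (Graph.irreflexive T (rank-injective x≡y) xy)
    ... | tri< x<y _ _ = inj₁ (meet⇒top∈ x∈C (subst (_∈ D) (sym (earlier⇒parent xy x<y))
            (proj₁ (D.closed y∈D λ { refl →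
              <⇒≱ x<y (≤-trans u≤v (C.top-least x∈C)) }))))
    ... | tri> _ _ y<x with x ≟ᶠ v
    ...   | yes refl = inj₂ (subst (_∈ D) (earlier⇒parent (Graph.symmetric T xy) y<x) y∈D)
    ...   | no x≢v   = inj₁ (meet⇒top∈
              (subst (_∈ C) (sym (earlier⇒parent (Graph.symmetric T xy) y<x)) (proj₁ (C.closed x∈C x≢v)))
              y∈D)

  record Packing (k : ℕ) (R : Pred (Subset t) 0ℓ) : Set where
    field
      part    : Fin k → Subset t
      top     : Fin k → Fin t
      subtree : ∀ i → IsSubtree (part i) (top i)
      member  : ∀ i → R (part i)
      apart   : ∀ {i j} → i ≢ j → Apart T (part i) (part j)

    top∈ : ∀ i → top i ∈ part i
    top∈ i = IsSubtree.top∈ (subtree i)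

    overlap⇒≡ : ∀ {i j x} → x ∈ part i → x ∈ part j → i ≡ j
    overlap⇒≡ {i} {j} x∈i x∈j with i ≟ᶠ j
    ... | yes i≡j = i≡j
    ... | no i≢j  = contradiction refl (proj₁ (apart i≢j x∈i x∈j))

  PiercedBy : ∀ {k} → Vec (Fin t) k → Pred (Subset t) 0ℓ → Set
  PiercedBy zs R = ∀ C v → IsSubtree C v → R C → ∃ λ i → Pierces (lookup zs i) C

  module _ (em : ExcludedMiddle 0ℓ) where

    -- Starting at the vertex `v` of least rank, `C` collects what climbs to `v` inside `W`. No edge
    -- within `W` leaves `C`: a later neighbour climbs into `C` in one step, an earlier one is the
    -- parent and already lies on the climb, and `v` has no earlier neighbour in `W`.
    component : ∀ W → ∃ (_∈ W) → ∃₂ λ C v →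
      IsSubtree C v × C ⊆ W × (∀ {x y} → x ∈ C → Adj T x y → y ∈ W → y ∈ C)
    component W W≠∅ = C , v
      , record { top∈ = C⁺ top ; top-least = v≤ ∘ C⊆W ; closed = closed ∘ C⁻ }
      , C⊆W , λ x∈C xy y∈W → C⁺ (boundary (C⁻ x∈C) xy y∈W)
      where
      leastW = least em (_∈ W) rank W≠∅
      v = proj₁ leastW

      v≤ : ∀ {x} → x ∈ W → rank v ≤ rank x
      v≤ = proj₂ (proj₂ leastW)

      data Below : Fin t → Set where
        top  : Below v
        step : ∀ {x} → x ∈ W → rank (parent x) < rank x → Below (parent x) → Below x

      below? : Decidable Below
      below? x = em

      C = comprehension below?

      C⁺ : ∀ {x} → Below x → x ∈ C
      C⁺ = ∈-comprehension⁺ below?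

      C⁻ : ∀ {x} → x ∈ C → Below x
      C⁻ = ∈-comprehension⁻ below?

      Below⇒∈W : ∀ {x} → Below x → x ∈ W
      Below⇒∈W top            = proj₁ (proj₂ leastW)
      Below⇒∈W (step x∈W _ _) = x∈W

      C⊆W : C ⊆ W
      C⊆W = Below⇒∈W ∘ C⁻

      closed : ∀ {x} → Below x → x ≢ v → parent x ∈ C × rank (parent x) < rank x
      closed top             v≢v = contradiction refl v≢v
      closed (step _ p<x bp) _   = C⁺ bp , p<x

      boundary : ∀ {x y} → Below x → Adj T x y → y ∈ W → Below y
      boundary {x} {y} b xy y∈W with <-cmp (rank x) (rank y)
      ... | tri≈ _ x≡y _ = ⊥-elim (Graph.irreflexive T (rank-injective x≡y) xy)
      ... | tri< x<y _ _ =
        let x≡p = earlier⇒parent xy x<y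
        in step y∈W (subst (λ p → rank p < rank y) x≡p x<y) (subst Below x≡p b)
      ... | tri> _ _ y<x with b
      ...   | top         = contradiction (v≤ y∈W) (<⇒≱ y<x)
      ...   | step _ _ bp = subst Below (sym (earlier⇒parent (Graph.symmetric T xy) y<x)) bp

    -- Greedily, a member whose top has the largest rank is pierced together with all the members
    -- that touch it.
    packing⊎piercing : Fin t → ∀ k (R : Pred (Subset t) 0ℓ) →
                       Packing (suc k) R ⊎ ∃ λ (zs : Vec (Fin t) k) → PiercedBy zs R
    packing⊎piercing z₀ k R with em {∃ λ ((C , v) : Subset t × Fin t) → IsSubtree C v × R C}
    packing⊎piercing z₀ k R | no ¬R =
      inj₂ (Vec.replicate k z₀ , λ _ _ Cv RC → contradiction (_ , Cv , RC) ¬R)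
    packing⊎piercing z₀ zero R | yes ((C , v) , Cv , RC) = inj₁ record
      { part = λ _ → C ; top = λ _ → v ; subtree = λ _ → Cv ; member = λ _ → RC
      ; apart = λ { {zero} {zero} i≢i → contradiction refl i≢i } }
    packing⊎piercing z₀ (suc k) R | yes nonempty
      -- Minimising `t ∸ rank v` selects the top of largest rank, as all ranks are below `t`;
      -- `touch⇒pierces` then compares `C` with any other member.
      with least em (λ ((C , v) : Subset t × Fin t) → IsSubtree C v × R C) (λ (_ , v) → t ∸ rank v) nonempty
    ... | (C , v) , (Cv , RC) , highest
      with packing⊎piercing z₀ k (λ D → R D × ¬ Pierces v D)
    ...   | inj₂ (zs , pierced) = inj₂ (v Vec.∷ zs , pierced′)
      where
      pierced′ : PiercedBy (v Vec.∷ zs) R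
      pierced′ D u Du RD with em {Pierces v D}
      ... | yes v↓ = zero , v↓
      ... | no ¬v↓ = let i , zᵢ↓ = pierced D u Du (RD , ¬v↓) in suc i , zᵢ↓
    ...   | inj₁ P = inj₁ record
      { part    = λ { zero → C ; (suc i) → part i }
      ; top     = λ { zero → v ; (suc i) → top i }
      ; subtree = λ { zero → Cv ; (suc i) → subtree i }
      ; member  = λ { zero → RC ; (suc i) → proj₁ (member i) }
      ; apart   = λ
          { {zero}  {zero}  i≢i → contradiction refl i≢i
          ; {zero}  {suc j} _   → apart-C j
          ; {suc i} {zero}  _ x∈ y∈C → let y≢x , ¬yx = apart-C i y∈C x∈
                                       in y≢x ∘ sym , ¬yx ∘ Graph.symmetric T
          ; {suc i} {suc j} i≢j → apart (i≢j ∘ cong suc)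
          }
      }
      where
      open Packing P

      apart-C : ∀ j → Apart T C (part j)
      apart-C j x∈C y∈ = ¬touch ∘ inj₁ , ¬touch ∘ inj₂
        where
        ¬touch = proj₂ (member j) ∘ touch⇒pierces Cv (subtree j)
          (∸-cancelʳ-≤ (<⇒≤ (rank< (top j))) (highest (subtree j , proj₁ (member j)))) x∈C y∈

  packing⇒≤α : ∀ {k R} → Packing k R → k ≤ α T
  packing⇒≤α {k} P = ≤-trans (injective⇒≤∣p∣ S top-injective (λ i → ∈-comprehension⁺ top? (i , refl)))
    (v≤max⁺ 0 _ (inj₂ (Anyₚ.map⁺ (lose (∈-filter⁺ (isIndependent? T) (∈-subsets S) independent) ≤-refl))))
    where
    open Packing P

    top? : Decidable λ x → ∃ λ i → top i ≡ x
    top? x = any? λ i → top i ≟ᶠ x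

    S = comprehension top?

    top-injective : Injective _≡_ _≡_ top
    top-injective {i} {j} eq = overlap⇒≡ (top∈ i) (subst (_∈ part j) (sym eq) (top∈ j))

    independent : IsIndependent T S
    independent u v u∈S v∈S uv with ∈-comprehension⁻ top? u∈S | ∈-comprehension⁻ top? v∈S
    ... | i , refl | j , refl with i ≟ᶠ j
    ...   | yes refl = Graph.irreflexive T refl uv
    ...   | no i≢j   = proj₂ (apart i≢j (top∈ i) (top∈ j)) uv

-- Counting embeddings

-- Injectivity is asked on `C` only: `h` on `C` glued to another embedding outside need not be
-- injective, and `cover-fixed` glues in this way. Blow-ups recover injectivity by putting the image
-- of `h` into `X`.
record Reroutes (T : Graph t) (G : Graph n) (h : Fin t → Fin n) (C : Subset t) (X : List (Fin n))
                (g : Fin t → Fin n) : Set where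
  field
    outside   : ∀ {x} → x ∉ C → g x ≡ h x
    hom       : ∀ {x y} → Adj T x y → Adj G (g x) (g y)
    injective : ∀ {x y} → x ∈ C → y ∈ C → g x ≡ g y → x ≡ y
    avoids    : ∀ {x} → x ∈ C → g x ∉ˡ X

-- Equivalently up to constants, G contains many disjoint copies of C attached to h in the same way.
Rich : Graph t → Graph n → ℕ → (Fin t → Fin n) → Pred (Subset t) 0ℓ
Rich T G s h C = ∀ X → length X ≤ s → ∃ (Reroutes T G h C X)

Cover : Pred (Fin t → Fin n) 0ℓ → ℕ → Set
Cover P N = ∃ λ fs → length fs ≤ N × (∀ {h} → P h → Any (h ≗_) fs)

cover-∅ : ∀ {P : Pred (Fin t → Fin n) 0ℓ} {N} → ¬ ∃ P → Cover P N
cover-∅ ¬P = [] , z≤n , λ p → contradiction (_ , p) ¬P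

cover-⋃ : ∀ {I : Set} {P : Pred (Fin t → Fin n) 0ℓ} {N} (is : List I) (Q : I → Pred (Fin t → Fin n) 0ℓ) →
          (∀ i → Cover (Q i) N) → (∀ {h} → P h → Any (λ i → Q i h) is) → Cover P (length is * N)
cover-⋃ is Q covers P⊆Q =
    concatMap (proj₁ ∘ covers) is
  , length-concatMap-≤ _ (proj₁ ∘ proj₂ ∘ covers) is
  , λ p → Anyₚ.concatMap⁺ (proj₁ ∘ covers) (Any.map (λ {i} → proj₂ (proj₂ (covers i))) (P⊆Q p))

module _ (em : ExcludedMiddle 0ℓ) {T : Graph t} (elim : Elimination T) (G : Graph n) (s : ℕ) where

  open Elimination elim
  open Subtrees elim

  -- As the members of P agree off W, a component C of T[W] is attached to all of them in the same
  -- way; C is not pierced, so it is not rich and some s vertices hit C in every member.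
  cover-fixed : ∀ {k} (zs : Vec (Fin t) k) d W → ∣ W ∣ ≤ d →
    (∀ i → lookup zs i ∉ W × parent (lookup zs i) ∉ W) →
    (P : Pred (Fin t → Fin n) 0ℓ) → (∀ {h} → P h → IsEmbedding T G h × PiercedBy zs (Rich T G s h)) →
    (∀ {h h′} → P h → P h′ → ∀ {x} → x ∉ W → h x ≡ h′ x) →
    Cover P (suc (t * s) ^ d)
  cover-fixed zs d W W≤d zs∉W P good agree with em {∃ P}
  ... | no ¬P = cover-∅ ¬P
  ... | yes (h₀ , p₀) with nonempty? W
  -- All values are fixed, so one map remains; the `suc` in the bound leaves room for it even if
  -- `t * s` is zero.
  ...   | no W≡∅ = [ h₀ ] , m^n>0 (suc (t * s)) d , λ p → here λ x → agree p p₀ λ x∈W → W≡∅ (x , x∈W)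
  cover-fixed zs zero W W≤d zs∉W P good agree | yes _ | yes (w , w∈W) =
    contradiction (<-≤-trans (x∈p⇒∣p-x∣<∣p∣ w∈W) W≤d) n≮0
  cover-fixed zs (suc d) W W≤d zs∉W P good agree | yes (h₀ , p₀) | yes W≠∅
    with component em W W≠∅
  ... | C , v , Cv , C⊆W , boundary
    with em {∃ λ X → length X ≤ s × ¬ ∃ (Reroutes T G h₀ C X)}
  ...   | no ¬X = contradiction
            (λ X X≤s → decidable-stable em λ ¬g → ¬X (X , X≤s , ¬g)) ¬rich
    where
    ¬rich : ¬ Rich T G s h₀ C
    ¬rich rich with proj₂ (good p₀) C v Cv rich
    ... | i , inj₁ z∈C  = proj₁ (zs∉W i) (C⊆W z∈C)
    ... | i , inj₂ pz∈C = proj₂ (zs∉W i) (C⊆W pz∈C)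
  ...   | yes (X , X≤s , ¬reroutes) =
    -- Each member sends some vertex `x` of `C` to some `a` in `X`; there are at most `t * s` such
    -- pairs, and each branch fixes one more vertex.
    let fs , fs≤ , complete = cover-⋃ (cartesianProduct (allFin t) X) Q cover-Q P⊆Q
    in fs , ≤-trans fs≤ (*-monoˡ-≤ _ (begin
        length (cartesianProduct (allFin t) X) ≡⟨ length-cartesianProductWith _,_ (allFin t) X ⟩
        length (allFin t) * length X           ≡⟨ cong (_* length X) (length-tabulate {n = t} id) ⟩
        t * length X                           ≤⟨ *-monoʳ-≤ t X≤s ⟩
        t * s                                  ≤⟨ n≤1+n _ ⟩
        suc (t * s)                            ∎)) , complete
    where
    open ≤-Reasoning

    Q : Fin t × Fin n → Pred (Fin t → Fin n) 0ℓ
    Q (x , a) h = P h × x ∈ W × h x ≡ a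

    cover-Q : ∀ xa → Cover (Q xa) (suc (t * s) ^ d)
    cover-Q (x , a) with x ∈? W
    ... | no x∉W  = cover-∅ λ (_ , _ , x∈W , _) → x∉W x∈W
    ... | yes x∈W = cover-fixed zs d (W - x) (s≤s⁻¹ (≤-trans (x∈p⇒∣p-x∣<∣p∣ x∈W) W≤d))
      (λ i → proj₁ (zs∉W i) ∘ x∈p-y⇒x∈p W , proj₂ (zs∉W i) ∘ x∈p-y⇒x∈p W)
      (Q (x , a)) (good ∘ proj₁) agree′
      where
      agree′ : ∀ {h h′} → Q (x , a) h → Q (x , a) h′ → ∀ {y} → y ∉ W - x → h y ≡ h′ y
      agree′ (p , _ , hx) (p′ , _ , h′x) {y} y∉ with y ≟ᶠ x
      ... | yes refl = trans hx (sym h′x)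
      ... | no y≢x   = agree p p′ λ y∈W → y∉ (x∈p∧x≢y⇒x∈p-y y∈W y≢x)

    P⊆Q : ∀ {h} → P h → Any (λ xa → Q xa h) (cartesianProduct (allFin t) X)
    P⊆Q {h} p with em {∃ λ x → x ∈ C × h x ∈ˡ X}
    ... | yes (x , x∈C , hx∈X) =
      lose (∈-cartesianProduct⁺ (∈-allFin x) hx∈X) (p , C⊆W x∈C , refl)
    ... | no ¬hit = contradiction (g , reroutes) ¬reroutes
      where
      module h = IsEmbedding (proj₁ (good p))
      module h₀ = IsEmbedding (proj₁ (good p₀))

      g : Fin t → Fin n
      g x with x ∈? C
      ... | yes _ = h x
      ... | no _  = h₀ x

      g-in : ∀ {x} → x ∈ C → g x ≡ h x
      g-in {x} x∈C with x ∈? C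
      ... | yes _  = refl
      ... | no x∉C = contradiction x∈C x∉C

      g-out : ∀ {x} → x ∉ C → g x ≡ h₀ x
      g-out {x} x∉C with x ∈? C
      ... | yes x∈C = contradiction x∈C x∉C
      ... | no _    = refl

      -- The gluing respects edges because neighbours of `C` outside `C` lie outside `W`, where `h`
      -- and `h₀` agree.
      g-boundary : ∀ {x y} → x ∈ C → Adj T x y → g y ≡ h y
      g-boundary {x} {y} x∈C xy with y ∈? C
      ... | yes _  = refl
      ... | no y∉C = agree p₀ p (y∉C ∘ boundary x∈C xy)

      g-hom : ∀ {x y} → Adj T x y → Adj G (g x) (g y)
      g-hom {x} {y} xy = case ((x ∈? C) , (y ∈? C)) of λ where
        (yes x∈C , _)      → subst₂ (Adj G) (sym (g-in x∈C)) (sym (g-boundary x∈C xy)) (h.hom x y xy)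
        (no _ , yes y∈C)   → subst₂ (Adj G) (sym (g-boundary y∈C (Graph.symmetric T xy))) (sym (g-in y∈C))
                               (h.hom x y xy)
        (no x∉C , no y∉C)  → subst₂ (Adj G) (sym (g-out x∉C)) (sym (g-out y∉C)) (h₀.hom x y xy)

      reroutes : Reroutes T G h₀ C X g
      reroutes = record
        { outside   = g-out
        ; hom       = g-hom
        ; injective = λ x∈C y∈C eq → h.injective (trans (sym (g-in x∈C)) (trans eq (g-in y∈C)))
        ; avoids    = λ {x} x∈C gx∈X → ¬hit (x , x∈C , subst (_∈ˡ X) (g-in x∈C) gx∈X)
        }

  -- The factors count the piercing vertices `zs`, the images of the edges from these to their
  -- parents (a diagonal pair for a root), and the completions of such a choice.
  cover-embeddings : Fin t → ∀ {k} → (∀ {h} → IsEmbedding T G h → ¬ Packing (suc k) (Rich T G s h)) →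
    (ps : List (Fin n × Fin n)) → (∀ {u v} → Adj G u v → (u , v) ∈ˡ ps) →
    Cover (IsEmbedding T G) (t ^ k * ((n + length ps) ^ k * suc (t * s) ^ t))
  cover-embeddings z₀ {k} no-packing ps ps-complete =
    subst (Cover _) (cong (_* ((n + length ps) ^ k * suc (t * s) ^ t))
        (trans (length-vectors (allFin t) k) (cong (_^ k) (length-tabulate {n = t} id))))
      (cover-⋃ (vectors (allFin t) k) Q cover-Q λ h↪ → case packing⊎piercing em z₀ k _ of λ where
        (inj₁ packing)        → contradiction packing (no-packing h↪)
        (inj₂ (zs , pierced)) → lose (∈-vectors⁺ _ zs λ i → ∈-allFin _) (h↪ , pierced))
    where
    Q : Vec (Fin t) k → Pred (Fin t → Fin n) 0ℓ
    Q zs h = IsEmbedding T G h × PiercedBy zs (Rich T G s h)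

    pairs : List (Fin n × Fin n)
    pairs = map (λ v → v , v) (allFin n) ++ ps

    length-pairs : length pairs ≡ n + length ps
    length-pairs = trans (length-++ (map (λ v → v , v) (allFin n)))
      (cong (_+ length ps) (trans (length-map (λ v → v , v) (allFin n)) (length-tabulate {n = n} id)))

    pair-∈ : ∀ {h} → IsEmbedding T G h → ∀ z → (h (parent z) , h z) ∈ˡ pairs
    pair-∈ {h} h↪ z with parent-adj z
    ... | inj₁ p≡z = ∈-++⁺ˡ (subst (λ p → (h p , h z) ∈ˡ map (λ v → v , v) (allFin n)) (sym p≡z)
                       (∈-map⁺ (λ v → v , v) (∈-allFin (h z))))
    ... | inj₂ pz  = ∈-++⁺ʳ _ (ps-complete (IsEmbedding.hom h↪ _ _ pz))

    cover-Q : ∀ zs → Cover (Q zs) ((n + length ps) ^ k * suc (t * s) ^ t)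
    cover-Q zs = subst (Cover _) (cong (_* _) (trans (length-vectors pairs k) (cong (_^ k) length-pairs)))
      (cover-⋃ (vectors pairs k) Q′ cover-Q′ λ {h} (h↪ , pierced) →
        lose (∈-vectors⁺ pairs (Vec.map (λ z → h (parent z) , h z) zs)
               λ i → subst (_∈ˡ pairs) (sym (lookup-map i _ zs)) (pair-∈ h↪ (lookup zs i)))
          ((h↪ , pierced) , λ i → sym (lookup-map i _ zs)))
      where
      Q′ : Vec (Fin n × Fin n) k → Pred (Fin t → Fin n) 0ℓ
      Q′ ws h = Q zs h × ∀ i → (h (parent (lookup zs i)) , h (lookup zs i)) ≡ lookup ws i

      fixed? : Decidable λ x → ∃ λ i → lookup zs i ≡ x ⊎ parent (lookup zs i) ≡ x
      fixed? x = any? λ i → (lookup zs i ≟ᶠ x) ⊎-dec (parent (lookup zs i) ≟ᶠ x)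

      free? : Decidable λ x → ¬ ∃ λ i → lookup zs i ≡ x ⊎ parent (lookup zs i) ≡ x
      free? x = ¬? (fixed? x)

      cover-Q′ : ∀ ws → Cover (Q′ ws) (suc (t * s) ^ t)
      cover-Q′ ws = cover-fixed zs t (comprehension free?) (∣p∣≤n (comprehension free?))
        (λ i → (λ z∈ → ∈-comprehension⁻ free? z∈ (i , inj₁ refl))
             , (λ z∈ → ∈-comprehension⁻ free? z∈ (i , inj₂ refl)))
        (Q′ ws) proj₁ agree
        where
        agree : ∀ {h h′} → Q′ ws h → Q′ ws h′ → ∀ {x} → x ∉ comprehension free? → h x ≡ h′ x
        agree (_ , hw) (_ , h′w) {x} x∉
          with decidable-stable (fixed? x) (x∉ ∘ ∈-comprehension⁺ free?)
        ... | i , inj₁ refl = cong proj₂ (trans (hw i) (sym (h′w i)))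
        ... | i , inj₂ refl = cong proj₁ (trans (hw i) (sym (h′w i)))

-- Blow-ups

length-concat-tabulate : ∀ {k} (f : Fin k → Fin t → A) →
                         length (concat (tabulate (λ i → tabulate (f i)))) ≡ k * t
length-concat-tabulate {k = zero}  f = refl
length-concat-tabulate {t = t} {k = suc k} f = trans (length-++ (tabulate (f zero)))
  (cong₂ _+_ (length-tabulate (f zero)) (length-concat-tabulate (f ∘ suc)))

∈-concat-tabulate : ∀ {k} (f : Fin k → Fin t → A) i j → f i j ∈ˡ concat (tabulate (λ i → tabulate (f i)))
∈-concat-tabulate f i j = ∈-concat⁺′ (∈-tabulate⁺ j) (∈-tabulate⁺ {f = λ i → tabulate (f i)} i)

extendUnique : ∀ d (xs : List (Fin n)) → Unique xs → length xs + d ≤ n →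
               ∃ λ ys → Unique ys × length ys ≡ length xs + d × (∀ {x} → x ∈ˡ xs → x ∈ˡ ys)
extendUnique zero    xs xs! _  = xs , xs! , sym (+-identityʳ _) , id
extendUnique {n} (suc d) xs xs! ≤n with any? (λ x → ¬? (Any.any? (x ≟ᶠ_) xs))
... | no full =
  contradiction
    (≤-trans (≤-reflexive (sym (length-tabulate {n = n} id)))
      (Unique-⊆⇒length≤ (Uniqueₚ.allFin⁺ n) λ {x} _ →
        decidable-stable (Any.any? (x ≟ᶠ_) xs) λ x∉ → full (x , x∉)))
    (<⇒≱ (<-≤-trans (m<m+n (length xs) z<s) ≤n))
... | yes (x , x∉) =
  let ys , ys! , eq , xs⊆ys = extendUnique d (x ∷ xs) (Allₚ.¬Any⇒All¬ xs x∉ ∷ xs!)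
                                (subst (_≤ n) (+-suc (length xs) d) ≤n)
  in ys , ys! , trans eq (sym (+-suc (length xs) d)) , xs⊆ys ∘ there

-- Serves to cut a graph down to exactly `k` vertices while keeping prescribed ones: repetitions are
-- dropped and further vertices fill up the list.
enumeration : ∀ {k} (xs : List (Fin n)) → length xs ≤ k → k ≤ n →
              ∃ λ (ι : Fin k → Fin n) → Injective _≡_ _≡_ ι × (∀ {x} → x ∈ˡ xs → ∃ λ i → ι i ≡ x)
enumeration {k = k} xs xs≤k k≤n
  with extendUnique (k ∸ length ds) ds (UniqueDecₚ.deduplicate-! _≟ᶠ_ xs) (subst (_≤ _) (sym k≡) k≤n)
  where
  ds = deduplicate _≟ᶠ_ xs
  k≡ : length ds + (k ∸ length ds) ≡ k
  k≡ = m+[n∸m]≡n (≤-trans (length-deduplicate _≟ᶠ_ xs) xs≤k)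
... | ys , ys! , eq , ds⊆ys with trans eq (m+[n∸m]≡n (≤-trans (length-deduplicate _≟ᶠ_ xs) xs≤k))
...   | refl = List.lookup ys , Unique⇒lookup-injective ys! , λ x∈ →
        let x∈ys = ds⊆ys (∈-deduplicate⁺ _≟ᶠ_ x∈) in Any.index x∈ys , sym (Anyₚ.lookup-index x∈ys)

module BlowUps {T : Graph t} (elim : Elimination T) {N s : ℕ} {G : Graph N} {h : Fin t → Fin N}
               (h↪ : IsEmbedding T G h) {k : ℕ} (P : Subtrees.Packing elim k (Rich T G s h)) where

  open Subtrees elim
  open Packing P

  private
    module h = IsEmbedding h↪

  used : ∀ {l} → (Fin l → Fin t → Fin N) → List (Fin N)
  used g = concat (tabulate h ∷ tabulate (λ i → tabulate (g i)))

  length-used : ∀ {l} (g : Fin l → Fin t → Fin N) → length (used g) ≡ suc l * t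
  length-used g = trans (length-++ (tabulate h)) (cong₂ _+_ (length-tabulate h) (length-concat-tabulate g))

  record Copies {l} (p : Fin l → Fin k) (g : Fin l → Fin t → Fin N) : Set where
    field
      reroutes : ∀ i → Reroutes T G h (part (p i)) (tabulate h) (g i)
      disjoint : ∀ {i j x y} → i ≢ j → x ∈ part (p i) → y ∈ part (p j) → g i x ≢ g j y

  -- A greedy choice: the image of `h` and the other `l - 1` reroutes have at most `l * t` vertices,
  -- and richness allows all of them to be avoided. `p` tells which part each copy reroutes.
  copies : ∀ {l} (p : Fin l → Fin k) → l * t ≤ s → ∃ (Copies p)
  copies {zero}  p _   = (λ ()) , record { reroutes = λ () ; disjoint = λ {} }
  copies {suc l} p l≤s =
    let g , gs = copies (p ∘ suc) (≤-trans (m≤n+m (l * t) t) l≤s)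
        g₀ , r = member (p zero) (used g) (subst (_≤ s) (sym (length-used g)) l≤s)
        open Reroutes r using (avoids)
        g₀-disjoint : ∀ {j x y} → x ∈ part (p zero) → g₀ x ≢ g j y
        g₀-disjoint {j} {y = y} x∈ eq = avoids x∈
          (∈-++⁺ʳ (tabulate h) (subst (_∈ˡ _) (sym eq) (∈-concat-tabulate g j y)))
    in (λ { zero → g₀ ; (suc i) → g i }) , record
      { reroutes = λ where
          zero    → record
            { outside   = Reroutes.outside r
            ; hom       = Reroutes.hom r
            ; injective = Reroutes.injective r
            ; avoids    = λ x∈ → avoids x∈ ∘ ∈-++⁺ˡ
            }
          (suc i) → Copies.reroutes gs i
      ; disjoint = λ
          { {zero}  {zero}  i≢i → contradiction refl i≢i
          ; {zero}  {suc j} _ x∈ _ → g₀-disjoint x∈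
          ; {suc i} {zero}  _ _ y∈ → g₀-disjoint y∈ ∘ sym
          ; {suc i} {suc j} i≢j → Copies.disjoint gs (i≢j ∘ cong suc)
          }
      }

  module _ (q : ℕ) (kq≤s : k * q * t ≤ s) where

    private
      index : Fin (k * q) → Fin k
      index l = proj₁ (remQuot {k} q l)

      index-combine : ∀ i j → index (combine i j) ≡ i
      index-combine i j = cong proj₁ (remQuot-combine i j)

      g : Fin (k * q) → Fin t → Fin N
      g = proj₁ (copies index kq≤s)

      open Copies (proj₂ (copies index kq≤s))

      copy : Fin k → Fin q → Fin t → Fin N
      copy i j = g (combine i j)

      copy-reroutes : ∀ i j → Reroutes T G h (part i) (tabulate h) (copy i j)
      copy-reroutes i j = subst (λ l → Reroutes T G h (part l) (tabulate h) (copy i j))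
        (index-combine i j) (reroutes (combine i j))

      copy-≡ : ∀ {i j i′ j′ x y} → x ∈ part i → y ∈ part i′ → copy i j x ≡ copy i′ j′ y →
               combine i j ≡ combine i′ j′
      copy-≡ {i} {j} {i′} {j′} {x} {y} x∈ y∈ eq with combine i j ≟ᶠ combine i′ j′
      ... | yes same = same
      ... | no other = contradiction eq (disjoint other
              (subst (λ l → x ∈ part l) (sym (index-combine i j)) x∈)
              (subst (λ l → y ∈ part l) (sym (index-combine i′ j′)) y∈))

      copy≢h : ∀ {i j x} y → x ∈ part i → copy i j x ≢ h y
      copy≢h {i} {j} y x∈ eq = Reroutes.avoids (copy-reroutes i j) x∈
        (subst (_∈ˡ tabulate h) (sym eq) (∈-tabulate⁺ y))

      part? : ∀ x → Dec (∃ λ i → x ∈ part i)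
      part? x = any? λ i → x ∈? part i

    verts : List (Fin N)
    verts = used g

    length-verts : length verts ≡ suc (k * q) * t
    length-verts = length-used g

    combined : Vec (Fin q) k → Fin t → Fin N
    combined c x with part? x
    ... | yes (i , _) = copy i (lookup c i) x
    ... | no _        = h x

    combined∈verts : ∀ c x → combined c x ∈ˡ verts
    combined∈verts c x with part? x
    ... | yes (i , _) = ∈-++⁺ʳ (tabulate h) (∈-concat-tabulate g (combine i (lookup c i)) x)
    ... | no _        = ∈-++⁺ˡ (∈-tabulate⁺ x)

    private
      combined-in : ∀ c {i x} → x ∈ part i → combined c x ≡ copy i (lookup c i) x
      combined-in c {x = x} x∈ with part? x
      ... | yes (j , x∈j) with refl ← overlap⇒≡ x∈ x∈j = refl
      ... | no x∉         = contradiction (_ , x∈) x∉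

      combined-out : ∀ c {x} → ¬ (∃ λ i → x ∈ part i) → combined c x ≡ h x
      combined-out c {x} x∉ with part? x
      ... | yes x∈ = contradiction x∈ x∉
      ... | no _   = refl

      -- Here non-adjacency of the parts enters: a neighbour of `part i` lies in `part i` or in no
      -- part at all, and in the latter case the copy agrees with `h`. Thus a single reroute
      -- accounts for each edge that meets a part.
      combined-near : ∀ c {i x y} → x ∈ part i → Adj T x y → combined c y ≡ copy i (lookup c i) y
      combined-near c {i} {x} {y} x∈ xy with part? y
      ... | no y∉         = sym (Reroutes.outside (copy-reroutes i (lookup c i)) λ y∈ → y∉ (i , y∈))
      ... | yes (j , y∈j) with i ≟ᶠ j
      ...   | yes refl = refl
      ...   | no i≢j   = contradiction xy (proj₂ (apart i≢j x∈ y∈j))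

    IsEmbedding-combined : ∀ c → IsEmbedding T G (combined c)
    IsEmbedding-combined c = record { injective = injective ; hom = hom }
      where
      injective : Injective _≡_ _≡_ (combined c)
      injective {x} {y} eq = case (part? x , part? y) of λ where
        (yes (i , x∈) , yes (j , y∈)) →
          let eq′ = trans (sym (combined-in c x∈)) (trans eq (combined-in c y∈))
          in case combine-injectiveˡ i (lookup c i) j (lookup c j) (copy-≡ x∈ y∈ eq′) of λ where
            refl → Reroutes.injective (copy-reroutes i (lookup c i)) x∈ y∈ eq′
        (yes (i , x∈) , no y∉) → contradiction
          (trans (sym (combined-in c x∈)) (trans eq (combined-out c y∉))) (copy≢h y x∈)
        (no x∉ , yes (j , y∈)) → contradiction
          (trans (sym (combined-in c y∈)) (trans (sym eq) (combined-out c x∉))) (copy≢h x y∈)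
        (no x∉ , no y∉) → h.injective (trans (sym (combined-out c x∉)) (trans eq (combined-out c y∉)))

      hom : ∀ x y → Adj T x y → Adj G (combined c x) (combined c y)
      hom x y xy = case (part? x , part? y) of λ where
        (yes (i , x∈) , _) → subst₂ (Adj G) (sym (combined-in c x∈)) (sym (combined-near c x∈ xy))
          (Reroutes.hom (copy-reroutes i (lookup c i)) xy)
        (no _ , yes (j , y∈)) → subst₂ (Adj G)
          (sym (combined-near c y∈ (Graph.symmetric T xy))) (sym (combined-in c y∈))
          (Reroutes.hom (copy-reroutes j (lookup c j)) xy)
        (no x∉ , no y∉) → subst₂ (Adj G) (sym (combined-out c x∉)) (sym (combined-out c y∉))
          (h.hom x y xy)

    -- As `y` is arbitrary, the vertex set of the image alone determines `c`. Different choices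
    -- therefore give different subgraphs and not merely different embeddings.
    combined-separates : ∀ c c′ i {y} → combined c (top i) ≡ combined c′ y → lookup c i ≡ lookup c′ i
    combined-separates c c′ i {y} eq = case part? y of λ where
      (no y∉) → contradiction
        (trans (sym (combined-in c (top∈ i))) (trans eq (combined-out c′ y∉))) (copy≢h y (top∈ i))
      (yes (j , y∈)) →
        let same = copy-≡ (top∈ i) y∈ (trans (sym (combined-in c (top∈ i))) (trans eq (combined-in c′ y∈)))
        in case combine-injectiveˡ i (lookup c i) j (lookup c′ j) same of λ where
          refl → combine-injectiveʳ i (lookup c i) j (lookup c′ j) same

module _ (em : ExcludedMiddle ℓ) (T : Graph t) (elim : Elimination T) (ℱ : Family ℓ) where

  -- All `q ^ k` combined embeddings together use at most `suc (k * q) * t` vertices of `G`,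
  -- whatever `N` is, so they survive in a subgraph induced on `n` vertices.
  blowUp-≤-ex : ∀ {N s} (G : Graph N) {h} (h↪ : IsEmbedding T G h) → Free ℱ G →
                ∀ {k} (P : Subtrees.Packing elim k (Rich T G s h)) →
                ∀ q → suc (k * q) * t ≤ n → n ≤ s → n ≤ N → q ^ k ≤ ex em n T ℱ
  blowUp-≤-ex {n} {N} G h↪ free {k} P q size≤n n≤s n≤N =
    subst (_≤ ex em n T ℱ) (trans (length-map copy (vectors (allFin q) k))
        (trans (length-vectors (allFin q) k) (cong (_^ k) (length-tabulate {n = q} id))))
      (≤-ex em T ℱ G′ (Free-antitone {ℱ = ℱ} {G = G} {G′} (ι , IsEmbedding-induced G ι ι-injective) free)
        (Uniqueₚ.map⁺ copy-injective (vectors⁺ (Uniqueₚ.allFin⁺ q) k))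
        λ c∈ → let c , _ , c≡ = ∈-map⁻ copy c∈ in f c , f↪ c , c≡)
    where
    open BlowUps elim h↪ P
    open Subtrees.Packing P using (top)

    kq≤s = ≤-trans (m≤n+m (k * q * t) t) (≤-trans size≤n n≤s)

    enum = enumeration (verts q kq≤s) (subst (_≤ n) (sym (length-verts q kq≤s)) size≤n) n≤N

    ι : Fin n → Fin N
    ι = proj₁ enum

    ι-injective : Injective _≡_ _≡_ ι
    ι-injective = proj₁ (proj₂ enum)

    G′ : Graph n
    G′ = induced G ι

    φ : Vec (Fin q) k → Fin t → Fin N
    φ = combined q kq≤s

    f : Vec (Fin q) k → Fin t → Fin n
    f c x = proj₁ (proj₂ (proj₂ enum) (combined∈verts q kq≤s c x))

    ιf : ∀ c x → ι (f c x) ≡ φ c x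
    ιf c x = proj₂ (proj₂ (proj₂ enum) (combined∈verts q kq≤s c x))

    f↪ : ∀ c → IsEmbedding T G′ (f c)
    f↪ c = record
      { injective = λ {x} {y} eq → IsEmbedding.injective φ↪ (trans (sym (ιf c x)) (trans (cong ι eq) (ιf c y)))
      ; hom       = λ x y xy → induced⁺ G ι (subst₂ (Adj G) (sym (ιf c x)) (sym (ιf c y)) (IsEmbedding.hom φ↪ x y xy))
      }
      where φ↪ = IsEmbedding-combined q kq≤s c

    copy : Vec (Fin q) k → Candidate n
    copy c = imageOf T (f c)

    copy-injective : ∀ {c c′} → copy c ≡ copy c′ → c ≡ c′
    copy-injective {c} {c′} eq = lookup-extensional λ i →
      let y , fy≡ = ∈-comprehension⁻ (image? T (f c′)) (subst (λ S → f c (top i) ∈ proj₁ S) eq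
                      (∈-comprehension⁺ (image? T (f c)) (top i , refl)))
      in combined-separates q kq≤s c c′ i
           (trans (sym (ιf c (top i))) (trans (cong ι (sym fy≡)) (ιf c′ y)))

-- The exponent and the matching bounds

^-distribʳ-* : ∀ k m n → (m * n) ^ k ≡ m ^ k * n ^ k
^-distribʳ-* zero    m n = refl
^-distribʳ-* (suc k) m n = trans (cong (m * n *_) (^-distribʳ-* k m n))
  ([m*n]*[o*p]≡[m*o]*[n*p] m n (m ^ k) (n ^ k))

module _ (em : ExcludedMiddle ℓ) (T : Graph t) (ℱ : Family ℓ) (tree : IsTree T) where

  private
    em₀ : ExcludedMiddle 0ℓ
    em₀ {P} = map′ lower lift (em {Lift ℓ P})

    elim : Elimination T
    elim = forest⇒elimination T (IsTree.acyclic tree)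

    z₀ : Fin t
    z₀ = IsTree.nonempty tree

  open Subtrees elim

  -- `s` is at once the degree of richness and a lower bound on the order, so that subgraphs of any
  -- prescribed order can be taken. For `k = 0` only the order matters: `T` embeds in arbitrarily
  -- large ℱ-free graphs.
  LargePackings : ℕ → Set ℓ
  LargePackings k = ∀ s → ∃ λ N → s ≤ N × ∃ λ (G : Graph N) → Free ℱ G ×
    ∃ λ h → IsEmbedding T G h × Packing k (Rich T G s h)

  ¬LargePackings : ∀ {k} → ¬ LargePackings k →
    ∃ λ s → ∀ {n} → s ≤ n → (G : Graph n) → Free ℱ G → ∀ {h} → IsEmbedding T G h →
      ¬ Packing k (Rich T G s h)
  ¬LargePackings {k} ¬large
    with em {∃ λ s → ¬ ∃ λ N → s ≤ N × ∃ λ (G : Graph N) → Free ℱ G ×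
                        ∃ λ h → IsEmbedding T G h × Packing k (Rich T G s h)}
  ... | yes (s , ¬s) = s , λ s≤n G free h↪ P → ¬s (_ , s≤n , G , free , _ , h↪ , P)
  ... | no ¬bound    = contradiction (λ s → decidable-stable em λ ¬s → ¬bound (s , ¬s)) ¬large

  ex-lower : ∀ {k} → LargePackings k → (λ n → n ^ k) =O (λ n → ex em n T ℱ)
  ex-lower {k} large = (w + w) ^ k , w , bound
    where
    open ≤-Reasoning

    -- With `q = n / w` copies of each part, all copies and `h` fit into `n` vertices. As `q` is
    -- positive, rounding down loses at most a factor of two, hence `w + w`.
    w = suc k * t

    instance
      w≢0 : NonZero w
      w≢0 = >-nonZero (<-≤-trans (≤-<-trans z≤n (toℕ<n z₀)) (m≤m+n t (k * t)))

    bound : ∀ n → w ≤ n → n ^ k ≤ (w + w) ^ k * ex em n T ℱ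
    -- Richness `n` is enough, since the copies and `h` occupy at most `n` vertices.
    bound n w≤n = let N , n≤N , G , free , h , h↪ , P = large n in begin
      n ^ k                      ≤⟨ ^-monoˡ-≤ k n≤ ⟩
      ((w + w) * q) ^ k          ≡⟨ ^-distribʳ-* k (w + w) q ⟩
      (w + w) ^ k * q ^ k        ≤⟨ *-monoʳ-≤ ((w + w) ^ k)
                                      (blowUp-≤-ex em T elim ℱ G h↪ free P q size≤n ≤-refl n≤N) ⟩
      (w + w) ^ k * ex em n T ℱ  ∎
      where
      q = n / w

      1≤q : 1 ≤ q
      1≤q = m≥n⇒m/n>0 w≤n

      size≤n : suc (k * q) * t ≤ n
      size≤n = begin
        suc (k * q) * t  ≤⟨ *-monoˡ-≤ t (+-monoˡ-≤ (k * q) 1≤q) ⟩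
        suc k * q * t    ≡⟨ *-assoc (suc k) q t ⟩
        suc k * (q * t)  ≡⟨ cong (suc k *_) (*-comm q t) ⟩
        suc k * (t * q)  ≡⟨ *-assoc (suc k) t q ⟨
        w * q            ≡⟨ *-comm w q ⟩
        q * w            ≤⟨ m/n*n≤m n w ⟩
        n                ∎

      n≤ : n ≤ (w + w) * q
      n≤ = begin
        n                ≡⟨ m≡m%n+[m/n]*n n w ⟩
        n % w + q * w    ≤⟨ +-mono-≤ (<⇒≤ (m%n<n n w)) (≤-reflexive (*-comm q w)) ⟩
        w + w * q        ≤⟨ +-monoˡ-≤ (w * q) (≤-trans (≤-reflexive (sym (*-identityʳ w))) (*-monoʳ-≤ w 1≤q)) ⟩
        w * q + w * q    ≡⟨ *-distribʳ-+ q w w ⟨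
        (w + w) * q      ∎

  ex-upper : {F : Graph m} → ℱ m F → IsForest F → ∀ {k} → ¬ LargePackings (suc k) →
             (λ n → ex em n T ℱ) =O (λ n → n ^ k)
  ex-upper {m = m} {F} F∈ℱ forest {k} ¬large = t ^ k * (D ^ k * K) , s , bound
    where
    open ≤-Reasoning

    s = proj₁ (¬LargePackings ¬large)
    -- The image of a piercing edge is one of `n` diagonal pairs or of at most `n * (m + m)`
    -- oriented edges.
    D = suc (m + m)
    K = suc (t * s) ^ t

    bound : ∀ n → s ≤ n → ex em n T ℱ ≤ t ^ k * (D ^ k * K) * n ^ k
    bound n s≤n = ex-≤ em T ℱ λ G free →
      let F⊈G = λ (f , f↪) → free F F∈ℱ (_ , IsCopy-imageOf {f = f} f↪)
          ps , ps≤ , edges = edgeList em₀ (forest⇒elimination F forest) {G = G} F⊈G n ⊤ (≤-reflexive (∣⊤∣≡n n))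
          fs , fs≤ , complete = cover-embeddings em₀ elim G s z₀ {k}
            (proj₂ (¬LargePackings ¬large) s≤n G free) ps (edges ∈⊤ ∈⊤)
      in begin
        #copies T G                              ≤⟨ #copies-≤ T G fs (λ _ → complete) ⟩
        length fs                                ≤⟨ fs≤ ⟩
        t ^ k * ((n + length ps) ^ k * K)        ≤⟨ *-monoʳ-≤ (t ^ k) (*-monoˡ-≤ K (^-monoˡ-≤ k (begin
          n + length ps                            ≤⟨ +-monoʳ-≤ n ps≤ ⟩
          n + n * (m + m)                          ≡⟨ *-suc n (m + m) ⟨
          n * D                                    ≡⟨ *-comm n D ⟩
          D * n                                    ∎))) ⟩
        t ^ k * ((D * n) ^ k * K)                ≡⟨ cong (λ l → t ^ k * (l * K)) (^-distribʳ-* k D n) ⟩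
        t ^ k * (D ^ k * n ^ k * K)              ≡⟨ cong (t ^ k *_) (trans (*-assoc (D ^ k) (n ^ k) K)
                                                      (trans (cong (D ^ k *_) (*-comm (n ^ k) K))
                                                        (sym (*-assoc (D ^ k) K (n ^ k))))) ⟩
        t ^ k * (D ^ k * K * n ^ k)              ≡⟨ *-assoc (t ^ k) (D ^ k * K) (n ^ k) ⟨
        t ^ k * (D ^ k * K) * n ^ k              ∎

  -- Every embedding admits the empty packing, so failure at `0` leaves no embedding of `T` in any
  -- large ℱ-free graph.
  ex-vanishes : ¬ LargePackings 0 → ∃ λ N → ∀ n → N ≤ n → ex em n T ℱ ≡ 0
  ex-vanishes ¬large = let s , none = ¬LargePackings ¬large in s , λ n s≤n →
    n≤0⇒n≡0 (ex-≤ em T ℱ λ G free → #copies-≤ T G [] λ h h↪ →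
      contradiction empty (none s≤n G free h↪))
    where
    empty : ∀ {R} → Packing 0 R
    empty = record { part = λ () ; top = λ () ; subtree = λ () ; member = λ () ; apart = λ {} }

  LargePackings⇒≤α : ∀ {k} → LargePackings k → k ≤ α T
  LargePackings⇒≤α large = let _ , _ , _ , _ , _ , _ , P = large 0 in packing⇒≤α P

  -- A downward search, to be started at `α T`, beyond which no packing exists. Success at `k` gives
  -- the lower bound and failure at `suc k` the upper one.
  largest : ∀ j → LargePackings 0 → ¬ LargePackings (suc j) →
            ∃ λ k → LargePackings k × ¬ LargePackings (suc k)
  largest zero    large₀ ¬large = 0 , large₀ , ¬large
  largest (suc j) large₀ ¬large with em {LargePackings (suc j)}
  ... | yes large  = suc j , large , ¬large
  ... | no ¬largeⱼ = largest j large₀ ¬largeⱼ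

corollary2p6 : ∀ {ℓ} (em : ExcludedMiddle ℓ) {t : ℕ} (T : Graph t) (ℱ : Family ℓ) →
    IsTree T → ¬ (T ≅ K₁) →
    (∃₂ λ m (F : Graph m) → ℱ m F × IsForest F) →
    (∃ λ k → k ≤ α T × (λ n → ex em n T ℱ) =Θ (λ n → n ^ k)) ⊎
    (∃ λ N → ∀ n → N ≤ n → ex em n T ℱ ≡ 0)
corollary2p6 em T ℱ tree _ (_ , F , F∈ℱ , forest) with em {LargePackings em T ℱ tree 0}
... | no ¬large₀ = inj₂ (ex-vanishes em T ℱ tree ¬large₀)
... | yes large₀ =
  let k , large , ¬large = largest em T ℱ tree (α T) large₀ (1+n≰n ∘ LargePackings⇒≤α em T ℱ tree)
  in inj₁ (k , LargePackings⇒≤α em T ℱ tree large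
            , ex-upper em T ℱ tree F∈ℱ forest ¬large , ex-lower em T ℱ tree large)
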